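{- Let $p,s\geq 1$ be integers and set $m_{p,s}:=(s-2)F_{2p-1}+2F_{2p+1}=sF_{2p-1}+2F_{2p}$. Then: (i) $\tau(\mathrm{Cone}(CT(p,s))) = 2^{s-1} m_{p,s}$; (ii) $$K(\mathrm{Cone}(CT(p,s))) \cong \begin{cases} \mathbb{Z}_2^{s-1}\oplus \mathbb{Z}_{m_{p,s}} & \text{if } s=1 \text{ or } p\equiv 2 \pmod 3,\\ \mathbb{Z}_2^{s-2}\oplus \mathbb{Z}_{2m_{p,s}} & \text{if } s\geq 2 \text{ and } p\equiv 0,1 \pmod 3.\end{cases}$$
   Context: $F_n$ are the Fibonacci numbers: $F_0=0$, $F_1=1$, $F_n=F_{n-1}+F_{n-2}$; $\mathbb{Z}_m:=\mathbb{Z}/m\mathbb{Z}$. For $p,s\geq1$ the coconut tree $CT(p,s)$ is obtained from a path on vertices $\pi_1,\dots,\pi_p$ (edges $\{\pi_i,\pi_{i+1}\}$) by adding $s$ new leaf vertices $\sigma_1,\dots,\sigma_s$, each adjacent only to $\pi_p$. For a tree $T$, $\mathrm{Cone}(T)$ is obtained by adding a new vertex $v_0$ joined by one edge to each vertex of $T$. For a finite connected graph $G$, $\tau(G)$ is its number of spanning trees and $K(G)=\mathbb{Z}^{V-\{v_0\}}/\operatorname{im}\overline{L}_G$ its sandpile group, where $L_G$ is the Laplacian (diagonal entries the degrees, off-diagonal entries minus the number of edges joining the two vertices) and $\overline{L}_G$ is $L_G$ with the row and column of a root vertex $v_0$ removed. -}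

module Defs where

open import Level using (0ℓ)
open import Data.Bool using (Bool; true; false; if_then_else_; _∧_; _∨_; _xor_)
open import Data.Nat as ℕ using (ℕ; zero; suc; _∸_)
open import Data.Fin as Fin using (Fin; zero; suc; _↑ˡ_; _↑ʳ_; fromℕ; _≟_)
open import Data.Fin.Subset using (Subset; _∈_; _─_; ⁅_⁆)
open import Data.List using (List; []; _∷_; _++_; map; length; lookup; filterᵇ; allFin)
open import Data.List.Relation.Unary.Unique.Propositional using (Unique)
import Data.List.Membership.Propositional as LMem
open import Data.Integer as ℤ using (ℤ; +_; -_)
open import Data.Integer.Divisibility using () renaming (_∣_ to _∣ℤ_)
open import Data.Product using (Σ; ∃; _×_; _,_; proj₁; proj₂)
open import Data.Sum using (_⊎_)
open import Relation.Binary.PropositionalEquality using (_≡_)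
open import Relation.Nullary using (¬_; ⌊_⌋)
open import Algebra.Bundles.Raw using (RawGroup)
open import Algebra.Morphism.Structures using (module GroupMorphisms)

fib : ℕ → ℕ
fib zero = 0
fib (suc zero) = 1
fib (suc (suc n)) = fib (suc n) ℕ.+ fib n

m : ℕ → ℕ → ℕ
m p s = s ℕ.* fib (2 ℕ.* p ∸ 1) ℕ.+ 2 ℕ.* fib (2 ℕ.* p)

-- Finite (multi)graphs: vertex set Fin V, edges a list of (unordered)
-- pairs of endpoints.

Edge : ℕ → Set
Edge V = Fin V × Fin V

Joins : ∀ {V} → Edge V → Fin V → Fin V → Set
Joins (a , b) u v = (a ≡ u × b ≡ v) ⊎ (a ≡ v × b ≡ u)

module _ {V : ℕ} (E : List (Edge V)) where

  EdgeSet : Set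
  EdgeSet = Subset (length E)

  data Reach (S : EdgeSet) : Fin V → Fin V → Set where
    here : ∀ {u} → Reach S u u
    step : ∀ {u v w} (e : Fin (length E)) → e ∈ S →
           Joins (lookup E e) u v → Reach S v w → Reach S u w

  Connected : EdgeSet → Set
  Connected S = ∀ u v → Reach S u v

  -- no cycles: every edge of S is a bridge of (V , S), i.e. its
  -- endpoints are not connected once it is removed (a loop is a cycle)
  Acyclic : EdgeSet → Set
  Acyclic S = ∀ e → e ∈ S →
    ¬ Reach (S ─ ⁅ e ⁆) (proj₁ (lookup E e)) (proj₂ (lookup E e))

  IsSpanningTree : EdgeSet → Set
  IsSpanningTree S = Connected S × Acyclic S

  NumSpanningTrees : ℕ → Set
  NumSpanningTrees k =
    Σ (List EdgeSet) λ L →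
      Unique L ×
      (∀ S → (S LMem.∈ L → IsSpanningTree S) × (IsSpanningTree S → S LMem.∈ L)) ×
      length L ≡ k

  mult : Fin V → Fin V → ℕ
  mult u v = length (filterᵇ (λ { (a , b) →
      (⌊ a ≟ u ⌋ ∧ ⌊ b ≟ v ⌋) ∨ (⌊ a ≟ v ⌋ ∧ ⌊ b ≟ u ⌋) }) E)

  deg : Fin V → ℕ
  deg u = length (filterᵇ (λ { (a , b) → ⌊ a ≟ u ⌋ xor ⌊ b ≟ u ⌋ }) E)

  Laplacian : Fin V → Fin V → ℤ
  Laplacian u v = if ⌊ u ≟ v ⌋ then + deg u else - (+ mult u v)

sumℤ : ∀ {n} → (Fin n → ℤ) → ℤ
sumℤ {zero} f = + 0
sumℤ {suc n} f = f zero ℤ.+ sumℤ (λ i → f (suc i))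

_·_ : ∀ {k n} → (Fin k → Fin n → ℤ) → (Fin n → ℤ) → Fin k → ℤ
(M · x) i = sumℤ (λ j → M i j ℤ.* x j)

-- Sandpile group of a graph on Fin (suc n), rooted at v0 = zero:
-- K(G) = ℤ^{V - v0} / im L̄ , presented as a raw group on ℤ^n whose
-- equality is congruence modulo im L̄.

module _ {n : ℕ} (E : List (Edge (suc n))) where

  reducedLaplacian : Fin n → Fin n → ℤ
  reducedLaplacian i j = Laplacian E (suc i) (suc j)

  SandpileGroup : RawGroup 0ℓ 0ℓ
  SandpileGroup = record
    { Carrier = Fin n → ℤ
    ; _≈_ = λ x y → ∃ λ z → ∀ i → x i ℤ.- y i ≡ (reducedLaplacian · z) i
    ; _∙_ = λ x y i → x i ℤ.+ y i
    ; ε = λ _ → + 0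
    ; _⁻¹ = λ x i → - x i
    }

-- ℤ_{d_1} ⊕ … ⊕ ℤ_{d_k}, presented as ℤ^k modulo d_1ℤ × … × d_kℤ
CyclicSum : List ℕ → RawGroup 0ℓ 0ℓ
CyclicSum ds = record
  { Carrier = Fin (length ds) → ℤ
  ; _≈_ = λ x y → ∀ i → (+ lookup ds i) ∣ℤ (x i ℤ.- y i)
  ; _∙_ = λ x y i → x i ℤ.+ y i
  ; ε = λ _ → + 0
  ; _⁻¹ = λ x i → - x i
  }

SandpileIso : ∀ {n} → List (Edge (suc n)) → List ℕ → Set
SandpileIso E ds =
  ∃ λ f → GroupMorphisms.IsGroupIsomorphism (SandpileGroup E) (CyclicSum ds) f

-- Coconut tree CT(p,s) on vertices Fin (p + s):
--   π_{i+1} ↦ i ↑ˡ s  (i : Fin p),   σ_{j+1} ↦ p ↑ʳ j  (j : Fin s)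

pathEdges : (p : ℕ) → List (Edge p)
pathEdges zero = []
pathEdges (suc zero) = []
pathEdges (suc (suc p)) =
  (zero , suc zero) ∷ map (λ { (a , b) → (suc a , suc b) }) (pathEdges (suc p))

ctEdges : (p s : ℕ) → List (Edge (p ℕ.+ s))
ctEdges zero s = []      -- unused: the theorem assumes p ≥ 1
ctEdges (suc p) s =
  map (λ { (a , b) → (a ↑ˡ s , b ↑ˡ s) }) (pathEdges (suc p)) ++
  map (λ j → (fromℕ p ↑ˡ s , suc p ↑ʳ j)) (allFin s)

coneEdges : ∀ {N} → List (Edge N) → List (Edge (suc N))
coneEdges {N} E =
  map (λ { (a , b) → (suc a , suc b) }) E ++ map (λ v → (zero , suc v)) (allFin N)

coneCT : (p s : ℕ) → List (Edge (suc (p ℕ.+ s)))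
coneCT p s = coneEdges (ctEdges p s)

{-# OPTIONS --safe #-}
module Submission where

-- Spanning trees: grow the cone one tree vertex w at a time, each new w being
-- joined to an old tree vertex u and to the root r.  If T counts the spanning
-- trees and F the spanning forests with two components separating u from r, then
-- adding w turns T into 2T + F, while F becomes T + F if w takes over the role of
-- u (a new end of the path) and 2F if u keeps it (a new leaf).  The path
-- recursion is that of the Fibonacci numbers.
--
-- Sandpile group: the path rows of L̄ z = x determine z along the path from its
-- value b at π₁ by z (i + 1) = 3 z i − z (i − 1) − x i, so z at π_p is
-- F_{2p−1} b + v with v linear in x.  The leaf rows then read
-- 2 w j = x j + F_{2p−1} b + v, and the row of π_p becomes m b = g for a linear
-- form g in x.  Hence x lies in the image of L̄ iff some integer b satisfies
-- m b = g and makes all but one of the x j + F_{2p−1} b + v even; the remaining w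
-- is given by the row of π_p.  If F_{2p−1} is even, that is p ≡ 2 (mod 3), these
-- are separate conditions on g mod m and on parities; if it is odd, one parity
-- condition prescribes b mod 2 and merges with m b = g into one condition mod 2m.

open import Defs
open import Data.Bool using (Bool; true; false; if_then_else_; _∧_; _∨_; _xor_)
open import Data.Empty using (⊥; ⊥-elim)
open import Data.Fin using (Fin; zero; suc; _≟_; punchIn; punchOut; cast; _↑ʳ_)
open import Data.List using (List; []; _∷_; _++_; map; length; allFin; replicate)
import Data.List as List
open import Data.List.Properties using (length-map; length-++; map-++; map-∘; map-tabulate)
open import Data.Nat as ℕ using (ℕ; zero; suc; _≤_; _^_; _∸_; _%_; s≤s)
import Data.Nat.Tactic.RingSolver as ℕ-solver
open import Data.Product using (Σ; ∃; _×_; _,_; proj₁; proj₂)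
open import Data.Sum using (_⊎_; inj₁; inj₂)
import Data.Sum as Sum
open import Function using (_∘_; id; case_of_; _⇔_; mk⇔; Equivalence; _↔_; mk↔ₛ′; Inverse)
open import Relation.Binary.PropositionalEquality using (_≡_; _≢_; refl; sym; trans; cong; cong₂; subst)
open import Relation.Nullary using (¬_; yes; no; does; ⌊_⌋)

open Equivalence using (to; from)

-- The index 2p - 1 with p = q + 1 is written `suc (q * 2)`, because `suc q * 2` reduces to
-- `suc (suc (q * 2))`; passing from p to p + 1 then unfolds `fib` by computation.
m-fib : ∀ q s → m (suc q) s ≡ s ℕ.* fib (suc (q ℕ.* 2)) ℕ.+ 2 ℕ.* fib (suc (suc (q ℕ.* 2)))
m-fib q s = cong (λ i → s ℕ.* fib i ℕ.+ 2 ℕ.* fib (suc i)) (index q)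
  where
  index : ∀ q → q ℕ.+ suc (q ℕ.+ 0) ≡ suc (q ℕ.* 2)
  index = ℕ-solver.solve-∀

-- Counting the spanning trees of the cone.

module SpanningTrees where

  open import Data.Fin.Properties using (suc-injective; punchOut-punchIn; punchIn-punchOut; punchOut-cong; punchInᵢ≢i; cast-involutive)
  open import Data.Fin.Subset using (Subset; _∈_; _─_; ⁅_⁆)
  open import Data.Fin.Subset.Properties using (p─q⊆p; x∈p∧x≢y⇒x∈p-y)
  open import Data.List.Membership.Propositional using () renaming (_∈_ to _∈ᴸ_)
  open import Data.List.Membership.Propositional.Properties using (∈-map⁺; ∈-map⁻; ∈-++⁺ˡ; ∈-++⁺ʳ; ∈-++⁻)
  open import Data.List.Relation.Binary.Permutation.Propositional as Perm using (_↭_; ↭⇒↭ₛ; prep; swap; ↭-trans; ↭-sym; ↭-reflexive)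
  open import Data.List.Relation.Binary.Permutation.Propositional.Properties using (shift; ++⁺ˡ)
  open import Data.List.Relation.Binary.Permutation.Setoid using (onIndices)
  open import Data.List.Relation.Binary.Permutation.Setoid.Properties using (onIndices-lookup)
  open import Data.List.Relation.Unary.All as All using ()
  open import Data.List.Relation.Unary.AllPairs using ([]; _∷_)
  open import Data.List.Relation.Unary.Any using (here)
  open import Data.List.Relation.Unary.Unique.Propositional using (Unique)
  import Data.List.Relation.Unary.Unique.Propositional.Properties as Unique
  open import Data.Maybe using (Maybe; just; nothing; maybe′)
  open import Data.Nat using (_+_; _*_)
  open import Data.Vec using (Vec; []; _∷_; lookup; tabulate; there)
  open import Data.Vec.Properties using (∷-injectiveʳ; lookup∘tabulate; tabulate∘lookup; tabulate-cong; []=⇒lookup; lookup⇒[]=)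
  import Relation.Binary.PropositionalEquality.Properties as ≡

  private
    variable
      A B V W : Set
      n n′ k l : ℕ

  -- `NumSpanningTrees E` unfolds to `Count (IsSpanningTree E)`. The general form also counts
  -- forests, and subsets whose first edges are prescribed.
  Count : (A → Set) → ℕ → Set
  Count P k = Σ (List _) λ L →
    Unique L × (∀ x → (x ∈ᴸ L → P x) × (P x → x ∈ᴸ L)) × length L ≡ k

  count-none : {P : A → Set} → (∀ x → ¬ P x) → Count P 0
  count-none ¬P = [] , [] , (λ x → (λ ()) , (λ p → ⊥-elim (¬P x p))) , refl

  count-[] : {P : Vec Bool 0 → Set} → P [] → Count P 1
  count-[] p = [] ∷ [] , All.[] ∷ [] , (λ { [] → (λ _ → p) , (λ _ → here refl) }) , refl

  count-bij : {P : A → Set} {P′ : B → Set} (f : A → B) (g : B → A) →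
    (∀ x → g (f x) ≡ x) → (∀ y → f (g y) ≡ y) → (∀ x → P x ⇔ P′ (f x)) →
    Count P k → Count P′ k
  count-bij {P = P} {P′} f g gf fg P⇔P′ (L , unique , mem , len) =
    map f L ,
    Unique.map⁺ (λ {x} {y} eq → trans (sym (gf x)) (trans (cong g eq) (gf y))) unique ,
    (λ y → fwd y , bwd y) ,
    trans (length-map f L) len
    where
    fwd : ∀ y → y ∈ᴸ map f L → P′ y
    fwd y y∈ with ∈-map⁻ f y∈
    ... | x , x∈ , refl = to (P⇔P′ x) (proj₁ (mem x) x∈)
    bwd : ∀ y → P′ y → y ∈ᴸ map f L
    bwd y p = subst (_∈ᴸ map f L) (fg y)
      (∈-map⁺ f (proj₂ (mem (g y)) (from (P⇔P′ (g y)) (subst P′ (sym (fg y)) p))))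

  count-resp : {P P′ : A → Set} → (∀ x → P x ⇔ P′ x) → Count P k → Count P′ k
  count-resp = count-bij id id (λ _ → refl) (λ _ → refl)

  count-∷ : {P : Vec Bool (suc n) → Set} →
    Count (P ∘ (true ∷_)) k → Count (P ∘ (false ∷_)) l → Count P (k + l)
  count-∷ {P = P} (K , uK , mK , lK) (L , uL , mL , lL) =
    map (true ∷_) K ++ map (false ∷_) L ,
    Unique.++⁺ (Unique.map⁺ ∷-injectiveʳ uK) (Unique.map⁺ ∷-injectiveʳ uL) disjoint ,
    (λ x → fwd x , bwd x) ,
    trans (length-++ (map (true ∷_) K))
      (cong₂ _+_ (trans (length-map _ K) lK) (trans (length-map _ L) lL))
    where
    disjoint : ∀ {x} → x ∈ᴸ map (true ∷_) K × x ∈ᴸ map (false ∷_) L → ⊥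
    disjoint (x∈K , x∈L) with ∈-map⁻ _ x∈K | ∈-map⁻ _ x∈L
    ... | _ , _ , refl | _ , _ , ()
    fwd : ∀ x → x ∈ᴸ map (true ∷_) K ++ map (false ∷_) L → P x
    fwd x x∈ with ∈-++⁻ (map (true ∷_) K) x∈
    ... | inj₁ x∈K with ∈-map⁻ _ x∈K
    ...   | y , y∈ , refl = proj₁ (mK y) y∈
    fwd x x∈ | inj₂ x∈L with ∈-map⁻ _ x∈L
    ...   | y , y∈ , refl = proj₁ (mL y) y∈
    bwd : ∀ x → P x → x ∈ᴸ map (true ∷_) K ++ map (false ∷_) L
    bwd (true  ∷ x) p = ∈-++⁺ˡ (∈-map⁺ _ (proj₂ (mK x) p))
    bwd (false ∷ x) p = ∈-++⁺ʳ _ (∈-map⁺ _ (proj₂ (mL x) p))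

  count-∷∷ : {P : Vec Bool (suc (suc n)) → Set} {k₁₁ k₁₀ k₀₁ k₀₀ : ℕ} →
    Count (λ S → P (true ∷ true ∷ S)) k₁₁ → Count (λ S → P (true ∷ false ∷ S)) k₁₀ →
    Count (λ S → P (false ∷ true ∷ S)) k₀₁ → Count (λ S → P (false ∷ false ∷ S)) k₀₀ →
    Count P ((k₁₁ + k₁₀) + (k₀₁ + k₀₀))
  count-∷∷ c₁₁ c₁₀ c₀₁ c₀₀ = count-∷ (count-∷ c₁₁ c₁₀) (count-∷ c₀₁ c₀₀)

  -- Walks, trees and two-component forests in abstract multigraphs.

  map² : (V → W) → V × V → W × W
  map² h (a , b) = h a , h b

  Joined : V × V → V → V → Set
  Joined e u v = e ≡ (u , v) ⊎ e ≡ (v , u)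

  -- Vertices form an arbitrary type and edge sets are arbitrary predicates, so that deleting an
  -- edge (`Without`) and adjoining a vertex (`Maybe V`) require no renumbering.
  data Walk {V : Set} {n} (ends : Fin n → V × V) (Q : Fin n → Set) : V → V → Set where
    here : ∀ {u} → Walk ends Q u u
    step : ∀ {u v w} e → Q e → Joined (ends e) u v → Walk ends Q v w → Walk ends Q u w

  Without : (Fin n → Set) → Fin n → Fin n → Set
  Without Q e e′ = Q e′ × e′ ≢ e

  module _ {n : ℕ} (ends : Fin n → V × V) (Q : Fin n → Set) where

    Conn : Set
    Conn = ∀ u v → Walk ends Q u v

    Acyc : Set
    Acyc = ∀ e → Q e → ¬ Walk ends (Without Q e) (proj₁ (ends e)) (proj₂ (ends e))

    Tree : Set
    Tree = Conn × Acyc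

    -- Covering all vertices from `r` and `u` while separating these two leaves exactly two
    -- components, one around each.
    Forest : V → V → Set
    Forest u r = Acyc × (∀ v → Walk ends Q v r ⊎ Walk ends Q v u) × ¬ Walk ends Q u r

  module _ {ends : Fin n → V × V} {Q : Fin n → Set} where

    edge : ∀ e → Q e → Walk ends Q (proj₁ (ends e)) (proj₂ (ends e))
    edge e q = step e q (inj₁ refl) here

    walk-trans : ∀ {u v w} → Walk ends Q u v → Walk ends Q v w → Walk ends Q u w
    walk-trans here           q = q
    walk-trans (step e s j p) q = step e s j (walk-trans p q)

    walk-sym : ∀ {u v} → Walk ends Q u v → Walk ends Q v u
    walk-sym here           = here
    walk-sym (step e s j p) = walk-trans (walk-sym p) (step e s (Sum.swap j) here)

    -- The induction on walks behind most later facts. With reachability for `P` it builds walks in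
    -- another graph; with an invariant for `P` it refutes walks.
    walk-elim : (P : V → Set) →
      (∀ e → Q e → (P (proj₁ (ends e)) → P (proj₂ (ends e))) × (P (proj₂ (ends e)) → P (proj₁ (ends e)))) →
      ∀ {u v} → Walk ends Q u v → P u → P v
    walk-elim P closed here p = p
    walk-elim P closed (step e q (inj₁ eq) w) p = walk-elim P closed w
      (subst (P ∘ proj₂) eq (proj₁ (closed e q) (subst (P ∘ proj₁) (sym eq) p)))
    walk-elim P closed (step e q (inj₂ eq) w) p = walk-elim P closed w
      (subst (P ∘ proj₁) eq (proj₂ (closed e q) (subst (P ∘ proj₂) (sym eq) p)))

  walk-map : ∀ {n n′} {ends : Fin n → V × V} {ends′ : Fin n′ → W × W} {Q Q′} (h : V → W) →
    (∀ e → Q e → Walk ends′ Q′ (h (proj₁ (ends e))) (h (proj₂ (ends e)))) →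
    ∀ {u v} → Walk ends Q u v → Walk ends′ Q′ (h u) (h v)
  walk-map {ends′ = ends′} {Q′ = Q′} h f {u} w = walk-elim (λ v → Walk ends′ Q′ (h u) (h v))
    (λ e q → (λ p → walk-trans p (f e q)) , (λ p → walk-trans p (walk-sym (f e q)))) w here

  walk-mono : {ends : Fin n → V × V} {Q Q′ : Fin n → Set} → (∀ e → Q e → Q′ e) →
    ∀ {u v} → Walk ends Q u v → Walk ends Q′ u v
  walk-mono sub = walk-map id (λ e q → edge e (sub e q))

  -- Adjoining a vertex by two edges.

  addVertex : (Fin n → V × V) → V → V → Fin (suc (suc n)) → Maybe V × Maybe V
  addVertex ends u r zero          = nothing , just u
  addVertex ends u r (suc zero)    = nothing , just r
  addVertex ends u r (suc (suc e)) = map² just (ends e)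

  module _ {ends : Fin n → V × V} {u r : V} where
    private
      ends⁺ : Fin (suc (suc n)) → Maybe V × Maybe V
      ends⁺ = addVertex ends u r

      old : (Fin (suc (suc n)) → Set) → Fin n → Set
      old Q e = Q (suc (suc e))

    lift-walk : ∀ {Q Q₀} → (∀ e → Q₀ e → old Q e) → ∀ {a b} → Walk ends Q₀ a b → Walk ends⁺ Q (just a) (just b)
    lift-walk sub = walk-map just (λ e q → edge (suc (suc e)) (sub e q))

    -- Contracts the new vertex onto `c`. A selected new edge whose old end is `c` becomes an empty
    -- walk, and old edges stay.
    collapse : ∀ {Q Q₀} c → (∀ e → old Q e → Q₀ e) → (Q zero → c ≡ u) → (Q (suc zero) → c ≡ r) →
      ∀ {a b} → Walk ends⁺ Q a b → Walk ends Q₀ (maybe′ id c a) (maybe′ id c b)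
    collapse {Q} {Q₀} c sub c≡u c≡r = walk-map (maybe′ id c) λ
      { zero          q → subst (Walk ends Q₀ c) (c≡u q) here
      ; (suc zero)    q → subst (Walk ends Q₀ c) (c≡r q) here
      ; (suc (suc e)) q → edge e (sub e q) }

    isolated : ∀ {Q v} → ¬ Q zero → ¬ Q (suc zero) → ¬ Walk ends⁺ Q nothing (just v)
    isolated ¬q₀ ¬q₁ w with walk-elim (_≡ nothing) (λ
      { zero          q → ⊥-elim (¬q₀ q)
      ; (suc zero)    q → ⊥-elim (¬q₁ q)
      ; (suc (suc e)) q → (λ ()) , (λ ()) }) w refl
    ... | ()

    private
      without-old : ∀ Q {e} e′ → Without (old Q) e e′ → old (Without Q (suc (suc e))) e′
      without-old Q e′ (q , ne) = q , ne ∘ suc-injective ∘ suc-injective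

      old-without : ∀ Q {e} e′ → old (Without Q (suc (suc e))) e′ → Without (old Q) e e′
      old-without Q e′ (q , ne) = q , ne ∘ cong (λ i → suc (suc i))

    acyc-restrict : ∀ {Q} → Acyc ends⁺ Q → Acyc ends (old Q)
    acyc-restrict {Q} acyc e q w = acyc (suc (suc e)) q (lift-walk (without-old Q) w)

    -- With at most one new edge selected, the new vertex is pendant or isolated. Removing its edge
    -- isolates it, and a cycle through an old edge would collapse to a cycle of the old graph.
    acyc-attach : ∀ {Q} c → (Q zero → c ≡ u) → (Q (suc zero) → c ≡ r) → (Q zero → ¬ Q (suc zero)) →
      Acyc ends (old Q) → Acyc ends⁺ Q
    acyc-attach c c≡u c≡r ¬both acyc zero q w =
      isolated (λ (_ , ne) → ne refl) (λ (q′ , _) → ¬both q q′) w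
    acyc-attach c c≡u c≡r ¬both acyc (suc zero) q w =
      isolated (λ (q′ , _) → ¬both q′ q) (λ (_ , ne) → ne refl) w
    acyc-attach {Q} c c≡u c≡r ¬both acyc (suc (suc e)) q w =
      acyc e q (collapse c (old-without Q) (c≡u ∘ proj₁) (c≡r ∘ proj₁) w)

    module _ {Q : Fin n → Set} where
      private
        -- Walks from a after a path u — nothing — r has been added, sorted by how
        -- they use that path.
        Via : V → Maybe V → Set
        Via a (just x) = Walk ends Q a x ⊎ (Walk ends Q a u × Walk ends Q r x) ⊎ (Walk ends Q a r × Walk ends Q u x)
        Via a nothing  = Walk ends Q a u ⊎ Walk ends Q a r

      through-new : ∀ {Q⁺ a b} → (∀ e → old Q⁺ e → Q e) → Walk ends⁺ Q⁺ (just a) (just b) →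
        Walk ends Q a b ⊎ (Walk ends Q a u × Walk ends Q r b) ⊎ (Walk ends Q a r × Walk ends Q u b)
      through-new {Q⁺} {a} sub w = walk-elim (Via a) closed w (inj₁ here)
        where
        closed : ∀ e → Q⁺ e → (Via a (proj₁ (ends⁺ e)) → Via a (proj₂ (ends⁺ e)))
                            × (Via a (proj₂ (ends⁺ e)) → Via a (proj₁ (ends⁺ e)))
        closed zero q =
          (λ { (inj₁ p) → inj₁ p ; (inj₂ p) → inj₂ (inj₂ (p , here)) }) ,
          (λ { (inj₁ p) → inj₁ p ; (inj₂ (inj₁ (p , _))) → inj₁ p ; (inj₂ (inj₂ (p , _))) → inj₂ p })
        closed (suc zero) q =
          (λ { (inj₁ p) → inj₂ (inj₁ (p , here)) ; (inj₂ p) → inj₁ p }) ,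
          (λ { (inj₁ p) → inj₂ p ; (inj₂ (inj₁ (p , _))) → inj₁ p ; (inj₂ (inj₂ (p , _))) → inj₂ p })
        closed (suc (suc e)) q = extend-by (edge e (sub e q)) , extend-by (walk-sym (edge e (sub e q)))
          where
          extend-by : ∀ {x y} → Walk ends Q x y → Via a (just x) → Via a (just y)
          extend-by t (inj₁ p)              = inj₁ (walk-trans p t)
          extend-by t (inj₂ (inj₁ (p , s))) = inj₂ (inj₁ (p , walk-trans s t))
          extend-by t (inj₂ (inj₂ (p , s))) = inj₂ (inj₂ (p , walk-trans s t))

    -- Without one new edge, contracting the new vertex onto the other old end would join `u` and
    -- `r`. Without an old edge, a walk between its ends either is an old cycle or passes through
    -- the new vertex, and then the edge itself completes an old walk between `u` and `r`.
    acyc-bridge : ∀ {Q} → ¬ Walk ends (old Q) u r → Acyc ends (old Q) → Acyc ends⁺ Q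
    acyc-bridge {Q} sep acyc zero q w = sep (walk-sym (collapse r (λ _ → proj₁) (λ (_ , ne) → ⊥-elim (ne refl)) (λ _ → refl) w))
    acyc-bridge {Q} sep acyc (suc zero) q w = sep (collapse u (λ _ → proj₁) (λ _ → refl) (λ (_ , ne) → ⊥-elim (ne refl)) w)
    acyc-bridge {Q} sep acyc (suc (suc e)) q w =
      Sum.[ acyc e q , Sum.[ (λ (p , s) → sep (walk-trans (walk-sym (keep p)) (walk-trans (edge e q) (walk-sym (keep s)))))
                           , (λ (p , s) → sep (walk-trans (keep s) (walk-trans (walk-sym (edge e q)) (keep p)))) ]′ ]′
        (through-new (old-without Q) w)
      where
      keep : ∀ {a b} → Walk ends (Without (old Q) e) a b → Walk ends (old Q) a b
      keep = walk-mono (λ _ → proj₁)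

  -- Selection by `lookup` computes on the two new edges of `b₁ ∷ b₂ ∷ S`: it holds by `refl` for
  -- `true` and is absurd for `false`. On old edges it reduces to `Sel S`.
  Sel : Subset n → Fin n → Set
  Sel S e = lookup S e ≡ true

  module _ {ends : Fin n → V × V} {u r : V} (S : Subset n) where
    private
      ends⁺ : Fin (suc (suc n)) → Maybe V × Maybe V
      ends⁺ = addVertex ends u r

      lift : ∀ {b₁ b₂ a b} → Walk ends (Sel S) a b → Walk ends⁺ (Sel (b₁ ∷ b₂ ∷ S)) (just a) (just b)
      lift {b₁} {b₂} = lift-walk {Q = Sel (b₁ ∷ b₂ ∷ S)} (λ _ q → q)

      to-u : ∀ {b} → Walk ends⁺ (Sel (true ∷ b ∷ S)) nothing (just u)
      to-u = edge zero refl

      to-r : ∀ {b} → Walk ends⁺ (Sel (b ∷ true ∷ S)) nothing (just r)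
      to-r = edge (suc zero) refl

      collapse-u : ∀ {a b} → Walk ends⁺ (Sel (true ∷ false ∷ S)) a b →
        Walk ends (Sel S) (maybe′ id u a) (maybe′ id u b)
      collapse-u = collapse {Q = Sel (true ∷ false ∷ S)} u (λ _ q → q) (λ _ → refl) (λ ())

      collapse-r : ∀ {a b} → Walk ends⁺ (Sel (false ∷ true ∷ S)) a b →
        Walk ends (Sel S) (maybe′ id r a) (maybe′ id r b)
      collapse-r = collapse {Q = Sel (false ∷ true ∷ S)} r (λ _ q → q) (λ ()) (λ _ → refl)

      collapse-∅ : ∀ {a b} → Walk ends⁺ (Sel (false ∷ false ∷ S)) a b →
        Walk ends (Sel S) (maybe′ id r a) (maybe′ id r b)
      collapse-∅ = collapse {Q = Sel (false ∷ false ∷ S)} r (λ _ q → q) (λ ()) (λ ())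

      attach-u : Acyc ends (Sel S) → Acyc ends⁺ (Sel (true ∷ false ∷ S))
      attach-u = acyc-attach {Q = Sel (true ∷ false ∷ S)} u (λ _ → refl) (λ ()) (λ _ ())

      attach-r : Acyc ends (Sel S) → Acyc ends⁺ (Sel (false ∷ true ∷ S))
      attach-r = acyc-attach {Q = Sel (false ∷ true ∷ S)} r (λ ()) (λ _ → refl) (λ ())

      attach-∅ : Acyc ends (Sel S) → Acyc ends⁺ (Sel (false ∷ false ∷ S))
      attach-∅ = acyc-attach {Q = Sel (false ∷ false ∷ S)} r (λ ()) (λ ()) (λ ())

      conn-via : ∀ {Q} c → Walk ends⁺ Q nothing (just c) →
        (∀ v → Walk ends⁺ Q (just v) (just c)) → Conn ends⁺ Q
      conn-via {Q} c w f x y = walk-trans (hub x) (walk-sym (hub y))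
        where
        hub : ∀ x → Walk ends⁺ Q x (just c)
        hub nothing  = w
        hub (just v) = f v

      reach-u⊎r : ∀ {b₁ b₂} v → Walk ends⁺ (Sel (b₁ ∷ b₂ ∷ S)) (just r) (just v) →
        Walk ends (Sel S) v r ⊎ Walk ends (Sel S) v u
      reach-u⊎r {b₁} {b₂} v w with through-new {Q = Sel S} {Q⁺ = Sel (b₁ ∷ b₂ ∷ S)} (λ _ q → q) w
      ... | inj₁ p              = inj₁ (walk-sym p)
      ... | inj₂ (inj₁ (_ , p)) = inj₁ (walk-sym p)
      ... | inj₂ (inj₂ (_ , p)) = inj₂ (walk-sym p)

    -- The two letters of a suffix tell whether the edges to `u` and to `r` are selected. If both
    -- are, they bridge the two components of the forest; conversely an old walk between `u` and `r`
    -- would close a cycle with them.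
    tree-tt : Forest ends (Sel S) u r ⇔ Tree ends⁺ (Sel (true ∷ true ∷ S))
    tree-tt = mk⇔
      (λ (acyc , cover , sep) →
        conn-via r to-r (λ v → Sum.[ lift , (λ p → walk-trans (lift p) (walk-trans (walk-sym to-u) to-r)) ]′ (cover v)) ,
        acyc-bridge sep acyc)
      (λ (conn , acyc) →
        acyc-restrict acyc ,
        (λ v → reach-u⊎r v (conn (just r) (just v))) ,
        (λ p → acyc zero refl (walk-trans
          (edge {Q = Without (Sel (true ∷ true ∷ S)) zero} (suc zero) (refl , λ ()))
          (lift-walk (λ _ q → q , λ ()) (walk-sym p)))))

    tree-tf : Tree ends (Sel S) ⇔ Tree ends⁺ (Sel (true ∷ false ∷ S))
    tree-tf = mk⇔
      (λ (conn , acyc) → conn-via u to-u (λ v → lift (conn v u)) , attach-u acyc)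
      (λ (conn , acyc) → (λ a b → collapse-u (conn (just a) (just b))) , acyc-restrict acyc)

    tree-ft : Tree ends (Sel S) ⇔ Tree ends⁺ (Sel (false ∷ true ∷ S))
    tree-ft = mk⇔
      (λ (conn , acyc) → conn-via r to-r (λ v → lift (conn v r)) , attach-r acyc)
      (λ (conn , acyc) → (λ a b → collapse-r (conn (just a) (just b))) , acyc-restrict acyc)

    tree-ff : ¬ Tree ends⁺ (Sel (false ∷ false ∷ S))
    tree-ff (conn , _) = isolated (λ ()) (λ ()) (conn nothing (just r))

    -- In the `path` lemmas the new vertex is the one to be separated from `r`. Hanging on `u`, it
    -- lies in the component of `u`, so separating either of the two is the same.
    path-tf : Forest ends (Sel S) u r ⇔ Forest ends⁺ (Sel (true ∷ false ∷ S)) nothing (just r)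
    path-tf = mk⇔
      (λ (acyc , cover , sep) →
        attach-u acyc ,
        (λ { nothing  → inj₂ here
           ; (just v) → Sum.map lift (λ p → walk-trans (lift p) (walk-sym to-u)) (cover v) }) ,
        (λ w → sep (collapse-u w)))
      (λ (acyc , cover , sep) →
        acyc-restrict acyc ,
        (λ v → Sum.map collapse-u collapse-u (cover (just v))) ,
        (λ p → sep (walk-trans to-u (lift p))))

    -- The new vertex is a component by itself, so the old vertices must all lie in the component of
    -- `r`.
    path-ff : Tree ends (Sel S) ⇔ Forest ends⁺ (Sel (false ∷ false ∷ S)) nothing (just r)
    path-ff = mk⇔
      (λ (conn , acyc) →
        attach-∅ acyc ,
        (λ { nothing → inj₂ here ; (just v) → inj₁ (lift (conn v r)) }) ,
        isolated (λ ()) (λ ()))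
      (λ (acyc , cover , sep) →
        (λ a b → walk-trans (to-root cover a) (walk-sym (to-root cover b))) , acyc-restrict acyc)
      where
      to-root : (∀ x → Walk ends⁺ (Sel (false ∷ false ∷ S)) x (just r) ⊎ Walk ends⁺ (Sel (false ∷ false ∷ S)) x nothing) →
        ∀ v → Walk ends (Sel S) v r
      to-root cover v = Sum.[ collapse-∅ , (λ w → ⊥-elim (isolated (λ ()) (λ ()) (walk-sym w))) ]′ (cover (just v))

    path-·t : ∀ b → ¬ Forest ends⁺ (Sel (b ∷ true ∷ S)) nothing (just r)
    path-·t b (_ , _ , sep) = sep to-r

    -- In the `leaf` lemmas `u` remains the vertex separated from `r`. Both new edges together would
    -- connect them; either one alone makes the new vertex pendant and keeps the old forest.
    leaf-tt : ¬ Forest ends⁺ (Sel (true ∷ true ∷ S)) (just u) (just r)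
    leaf-tt (_ , _ , sep) = sep (walk-trans (walk-sym to-u) to-r)

    leaf-tf : Forest ends (Sel S) u r ⇔ Forest ends⁺ (Sel (true ∷ false ∷ S)) (just u) (just r)
    leaf-tf = mk⇔
      (λ (acyc , cover , sep) →
        attach-u acyc ,
        (λ { nothing → inj₂ to-u ; (just v) → Sum.map lift lift (cover v) }) ,
        (λ w → sep (collapse-u w)))
      (λ (acyc , cover , sep) →
        acyc-restrict acyc ,
        (λ v → Sum.map collapse-u collapse-u (cover (just v))) ,
        (λ p → sep (lift p)))

    leaf-ft : Forest ends (Sel S) u r ⇔ Forest ends⁺ (Sel (false ∷ true ∷ S)) (just u) (just r)
    leaf-ft = mk⇔
      (λ (acyc , cover , sep) →
        attach-r acyc ,
        (λ { nothing → inj₁ to-r ; (just v) → Sum.map lift lift (cover v) }) ,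
        (λ w → sep (collapse-r w)))
      (λ (acyc , cover , sep) →
        acyc-restrict acyc ,
        (λ v → Sum.map collapse-r collapse-r (cover (just v))) ,
        (λ p → sep (lift p)))

    -- An isolated new vertex would be a third component.
    leaf-ff : ¬ Forest ends⁺ (Sel (false ∷ false ∷ S)) (just u) (just r)
    leaf-ff (_ , cover , _) =
      Sum.[ isolated (λ ()) (λ ()) , isolated (λ ()) (λ ()) ]′ (cover nothing)

  -- Recurrences for the numbers of trees and forests.

  Trees : (Fin n → V × V) → ℕ → Set
  Trees ends = Count (λ S → Tree ends (Sel S))

  Forests : (Fin n → V × V) → V → V → ℕ → Set
  Forests ends u r = Count (λ S → Forest ends (Sel S) u r)

  module _ {ends : Fin n → V × V} {u r : V} {t f : ℕ} (T : Trees ends t) (F : Forests ends u r f) where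

    -- The summands here and below belong to the selections tt, tf, ft, ff in this order, in the
    -- unsimplified form that `count-∷∷` yields.
    addVertex-trees : Trees (addVertex ends u r) ((f + t) + (t + 0))
    addVertex-trees = count-∷∷ (count-resp tree-tt F) (count-resp tree-tf T) (count-resp tree-ft T) (count-none tree-ff)

    addVertex-forests-new : Forests (addVertex ends u r) nothing (just r) ((0 + f) + (0 + t))
    addVertex-forests-new = count-∷∷ (count-none (λ S → path-·t S true)) (count-resp path-tf F) (count-none (λ S → path-·t S false)) (count-resp path-ff T)

    addVertex-forests-old : Forests (addVertex ends u r) (just u) (just r) ((0 + f) + (f + 0))
    addVertex-forests-old = count-∷∷ (count-none leaf-tt) (count-resp leaf-tf F) (count-resp leaf-ft F) (count-none leaf-ff)

  -- Invariance of the counts under graph isomorphism.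

  -- Orientations of edges need not agree.
  record _≅_ (ends : Fin n → V × V) (ends′ : Fin n′ → W × W) : Set where
    field
      edges : Fin n ↔ Fin n′
      verts : V ↔ W
      joins : ∀ e → Joined (ends′ (Inverse.to edges e))
                (Inverse.to verts (proj₁ (ends e))) (Inverse.to verts (proj₂ (ends e)))

  ≅-sym : {ends : Fin n → V × V} {ends′ : Fin n′ → W × W} → ends ≅ ends′ → ends′ ≅ ends
  ≅-sym {ends = ends} {ends′} iso = record
    { edges = mk↔ₛ′ E.from E.to E.strictlyInverseʳ E.strictlyInverseˡ
    ; verts = mk↔ₛ′ V.from V.to V.strictlyInverseʳ V.strictlyInverseˡ
    ; joins = λ e′ → flip-joined e′ (subst (λ x → Joined (ends′ x) _ _) (E.strictlyInverseˡ e′) (joins (E.from e′)))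
    }
    where
    open _≅_ iso
    module E = Inverse edges
    module V = Inverse verts
    flip-joined : ∀ e′ → Joined (ends′ e′) (V.to (proj₁ (ends (E.from e′)))) (V.to (proj₂ (ends (E.from e′)))) →
      Joined (ends (E.from e′)) (V.from (proj₁ (ends′ e′))) (V.from (proj₂ (ends′ e′)))
    flip-joined e′ (inj₁ eq) = inj₁ (sym (trans (cong (map² V.from) eq) (cong₂ _,_ (V.strictlyInverseʳ _) (V.strictlyInverseʳ _))))
    flip-joined e′ (inj₂ eq) = inj₂ (sym (trans (cong (λ (a , b) → V.from b , V.from a) eq) (cong₂ _,_ (V.strictlyInverseʳ _) (V.strictlyInverseʳ _))))

  -- Only one direction is proved; the equivalences instantiate it at `iso` and at `≅-sym iso`.
  module Transport {ends : Fin n → V × V} {ends′ : Fin n′ → W × W} (iso : ends ≅ ends′) where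
    open _≅_ iso
    private
      module E = Inverse edges
      module V = Inverse verts

    ≅-walk : ∀ {Q Q′} → (∀ e → Q e → Q′ (E.to e)) → ∀ {a b} → Walk ends Q a b → Walk ends′ Q′ (V.to a) (V.to b)
    ≅-walk sub = walk-map V.to (λ e q → step (E.to e) (sub e q) (joins e) here)

    ≅-acyc : ∀ {Q Q′} → (∀ e → Q e → Q′ (E.to e)) → Acyc ends′ Q′ → Acyc ends Q
    ≅-acyc sub acyc e q w = acyc (E.to e) (sub e q)
      (orient (joins e) (≅-walk (λ e′ (q′ , ne) → sub e′ q′ , λ eq → ne
        (trans (sym (E.strictlyInverseʳ e′)) (trans (cong E.from eq) (E.strictlyInverseʳ e)))) w))
      where
      orient : ∀ {Q a b} {x} → Joined x a b → Walk ends′ Q a b → Walk ends′ Q (proj₁ x) (proj₂ x)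
      orient (inj₁ refl) p = p
      orient (inj₂ refl) p = walk-sym p

  module _ {ends : Fin n → V × V} {ends′ : Fin n′ → W × W} (iso : ends ≅ ends′) where
    open _≅_ iso
    private
      module E = Inverse edges
      module V = Inverse verts
      module T = Transport iso
      module T⁻ = Transport (≅-sym iso)

    ≅-tree : ∀ {Q Q′} → (∀ e → Q e → Q′ (E.to e)) → (∀ e → Q′ e → Q (E.from e)) → Tree ends Q → Tree ends′ Q′
    ≅-tree {Q} {Q′} sub sup (conn , acyc) =
      (λ a b → subst₂-walk (T.≅-walk sub (conn (V.from a) (V.from b)))) ,
      T⁻.≅-acyc sup acyc
      where
      subst₂-walk : ∀ {a b} → Walk ends′ Q′ (V.to (V.from a)) (V.to (V.from b)) → Walk ends′ Q′ a b
      subst₂-walk {a} {b} rewrite V.strictlyInverseˡ a | V.strictlyInverseˡ b = id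

    ≅-forest : ∀ {Q Q′ u r} → (∀ e → Q e → Q′ (E.to e)) → (∀ e → Q′ e → Q (E.from e)) →
      Forest ends Q u r → Forest ends′ Q′ (V.to u) (V.to r)
    ≅-forest {Q} {Q′} {u} {r} sub sup (acyc , cover , sep) =
      T⁻.≅-acyc sup acyc ,
      (λ v → Sum.map (from-source v) (from-source v) (Sum.map (T.≅-walk sub) (T.≅-walk sub) (cover (V.from v)))) ,
      (λ w → sep (back (T⁻.≅-walk sup w)))
      where
      from-source : ∀ a {b} → Walk ends′ Q′ (V.to (V.from a)) b → Walk ends′ Q′ a b
      from-source a rewrite V.strictlyInverseˡ a = id
      back : Walk ends Q (V.from (V.to u)) (V.from (V.to r)) → Walk ends Q u r
      back rewrite V.strictlyInverseʳ u | V.strictlyInverseʳ r = id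

  reindex : (Fin n′ → Fin n) → Subset n → Subset n′
  reindex g S = tabulate (lookup S ∘ g)

  reindex-inverse : (f : Fin n → Fin n′) (g : Fin n′ → Fin n) → (∀ e → g (f e) ≡ e) →
    ∀ S → reindex f (reindex g S) ≡ S
  reindex-inverse f g gf S = trans
    (tabulate-cong (λ e → trans (lookup∘tabulate _ (f e)) (cong (lookup S) (gf e)))) (tabulate∘lookup S)

  module _ {ends : Fin n → V × V} {ends′ : Fin n′ → W × W} (iso : ends ≅ ends′) where
    open _≅_ iso
    private
      module E = Inverse edges
      module V = Inverse verts

      sub : ∀ S e → Sel S e → Sel (reindex E.from S) (E.to e)
      sub S e q = trans (lookup∘tabulate _ (E.to e)) (trans (cong (lookup S) (E.strictlyInverseʳ e)) q)

      sup : ∀ S e → Sel (reindex E.from S) e → Sel S (E.from e)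
      sup S e q = trans (sym (lookup∘tabulate _ e)) q

    ≅-trees : Trees ends k → Trees ends′ k
    ≅-trees = count-bij (reindex E.from) (reindex E.to)
      (reindex-inverse E.to E.from E.strictlyInverseʳ) (reindex-inverse E.from E.to E.strictlyInverseˡ)
      (λ S → mk⇔ (≅-tree iso (sub S) (sup S)) (≅-tree (≅-sym iso) (sup S) (sub S)))

    ≅-forests : ∀ {u r} → Forests ends u r k → Forests ends′ (V.to u) (V.to r) k
    ≅-forests {u = u} {r} = count-bij (reindex E.from) (reindex E.to)
      (reindex-inverse E.to E.from E.strictlyInverseʳ) (reindex-inverse E.from E.to E.strictlyInverseˡ)
      (λ S → mk⇔ (≅-forest iso (sub S) (sup S)) (λ F → back S (≅-forest (≅-sym iso) (sup S) (sub S) F)))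
      where
      back : ∀ S → Forest ends (Sel S) (V.from (V.to u)) (V.from (V.to r)) → Forest ends (Sel S) u r
      back S rewrite V.strictlyInverseʳ u | V.strictlyInverseʳ r = id

  -- Each cone as a smaller cone with one vertex added.

  punchInMaybe : Fin (suc n) → Maybe (Fin n) ↔ Fin (suc n)
  punchInMaybe {n} i = mk↔ₛ′ f g fg gf
    where
    f : Maybe (Fin n) → Fin (suc n)
    f nothing  = i
    f (just v) = punchIn i v
    g : Fin (suc n) → Maybe (Fin n)
    g x with i ≟ x
    ... | yes _  = nothing
    ... | no i≢x = just (punchOut i≢x)
    fg : ∀ x → f (g x) ≡ x
    fg x with i ≟ x
    ... | yes i≡x = i≡x
    ... | no i≢x  = punchIn-punchOut i≢x
    gf : ∀ x → g (f x) ≡ x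
    gf nothing with i ≟ i
    ... | yes _  = refl
    ... | no i≢i = ⊥-elim (i≢i refl)
    gf (just v) with i ≟ punchIn i v
    ... | yes eq = ⊥-elim (punchInᵢ≢i i v (sym eq))
    ... | no i≢  = cong just (trans (punchOut-cong i refl) (punchOut-punchIn i))

  -- The added vertex receives the number `i`, and `punchIn i` renumbers the old ones. The edge list
  -- of the larger cone has the new edges at other places, so it is compared up to permutation, and
  -- the permutation supplies the bijection of edge indices.
  addVertex-≅ : ∀ {N} {E : List (Edge N)} {E′ : List (Edge (suc N))} {e₁ e₂} (i : Fin (suc N)) (u r : Fin N) →
    Joined e₁ i (punchIn i u) → Joined e₂ i (punchIn i r) → e₁ ∷ e₂ ∷ map (map² (punchIn i)) E ↭ E′ →
    addVertex (List.lookup E) u r ≅ List.lookup E′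
  addVertex-≅ {N} {E} {E′} {e₁} {e₂} i u r j₁ j₂ perm = record
    { edges = mk↔ₛ′ (P.to ∘ grow) (shrink ∘ P.from)
        (λ e → trans (cong P.to (grow-shrink (P.from e))) (P.strictlyInverseˡ e))
        (λ e → trans (cong shrink (P.strictlyInverseʳ (grow e))) (shrink-grow e))
    ; verts = punchInMaybe i
    ; joins = λ e → subst (λ x → Joined x _ _) (onIndices-lookup (≡.setoid _) (↭⇒↭ₛ perm) (grow e)) (joins e)
    }
    where
    module P = Inverse (onIndices (↭⇒↭ₛ perm))
    len = length-map (map² (punchIn i)) E
    grow : Fin (suc (suc (length E))) → Fin (suc (suc (length (map (map² (punchIn i)) E))))
    grow zero          = zero
    grow (suc zero)    = suc zero
    grow (suc (suc e)) = suc (suc (cast (sym len) e))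
    shrink : Fin (suc (suc (length (map (map² (punchIn i)) E)))) → Fin (suc (suc (length E)))
    shrink zero          = zero
    shrink (suc zero)    = suc zero
    shrink (suc (suc e)) = suc (suc (cast len e))
    grow-shrink : ∀ e → grow (shrink e) ≡ e
    grow-shrink zero          = refl
    grow-shrink (suc zero)    = refl
    grow-shrink (suc (suc e)) = cong (λ x → suc (suc x)) (cast-involutive (sym len) len e)
    shrink-grow : ∀ e → shrink (grow e) ≡ e
    shrink-grow zero          = refl
    shrink-grow (suc zero)    = refl
    shrink-grow (suc (suc e)) = cong (λ x → suc (suc x)) (cast-involutive len (sym len) e)
    lookup-cast : ∀ (L : List (Edge N)) .(eq : length L ≡ length (map (map² (punchIn i)) L)) e →
      List.lookup (map (map² (punchIn i)) L) (cast eq e) ≡ map² (punchIn i) (List.lookup L e)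
    lookup-cast (x ∷ L) eq zero    = refl
    lookup-cast (x ∷ L) eq (suc e) = lookup-cast L (cong ℕ.pred eq) e
    joins : ∀ e → Joined (List.lookup (e₁ ∷ e₂ ∷ map (map² (punchIn i)) E) (grow e))
      (Inverse.to (punchInMaybe i) (proj₁ (addVertex (List.lookup E) u r e)))
      (Inverse.to (punchInMaybe i) (proj₂ (addVertex (List.lookup E) u r e)))
    joins zero          = j₁
    joins (suc zero)    = j₂
    joins (suc (suc e)) = inj₁ (lookup-cast E _ e)

  map-pieces : ∀ {X C : Set} {g : B → C} {l : X → C} {F : V → C} {g′ : A → V} {l′ : X → V} {h : A → B}
    (P : List A) (L : List X) → (∀ x → g (h x) ≡ F (g′ x)) → (∀ j → l j ≡ F (l′ j)) →
    map g (map h P) ++ map l L ≡ map F (map g′ P ++ map l′ L)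
  map-pieces [] [] p q = refl
  map-pieces {g = g} {h = h} [] (x ∷ L) p q = cong₂ _∷_ (q x) (map-pieces {g = g} {h = h} [] L p q)
  map-pieces {g = g} {h = h} (x ∷ P) L p q = cong₂ _∷_ (p x) (map-pieces {g = g} {h = h} P L p q)

  -- The path grows at its free end π₁, so the leaves keep their neighbour.
  ctEdges-suc : ∀ q s → ctEdges (suc (suc q)) s ≡ (zero , suc zero) ∷ map (map² suc) (ctEdges (suc q) s)
  ctEdges-suc q s = cong ((zero , suc zero) ∷_)
    (map-pieces {h = λ (a , b) → suc a , suc b} (pathEdges (suc q)) (allFin s) (λ _ → refl) (λ _ → refl))

  spoke : ∀ {N} → Fin N → Edge (suc N)
  spoke v = zero , suc v

  -- Position 1, next to the root, is that of the new π₁ and, in the old numbering, that of the old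
  -- π₁. The edge between them already heads the new list; only the new spoke has to move, past the
  -- tree edges.
  addPathVertex : ∀ q s → addVertex (List.lookup (coneCT (suc q) s)) (suc zero) zero ≅ List.lookup (coneCT (suc (suc q)) s)
  addPathVertex q s = addVertex-≅ (suc zero) (suc zero) zero (inj₁ refl) (inj₂ refl)
    (↭-trans
      (prep _ (↭-trans (prep _ (↭-reflexive old-edges)) (↭-sym (shift _ _ _))))
      (↭-reflexive (cong coneEdges (sym (ctEdges-suc q s)))))
    where
    old-edges : map (map² (punchIn (suc zero))) (coneCT (suc q) s) ≡ _
    old-edges = trans (map-++ _ (map _ (ctEdges (suc q) s)) _) (cong₂ _++_
      (trans (sym (map-∘ (ctEdges (suc q) s))) (map-∘ (ctEdges (suc q) s)))
      (trans (cong (map _) (map-tabulate id spoke)) (trans (map-tabulate spoke _) (sym (map-tabulate suc spoke)))))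

  -- Leaves are added while the path is the single vertex π₁, so the new leaf has position 2 and the
  -- rest of the path comes afterwards.
  addLeaf : ∀ s → addVertex (List.lookup (coneCT 1 s)) (suc zero) zero ≅ List.lookup (coneCT 1 (suc s))
  addLeaf s = addVertex-≅ (suc (suc zero)) (suc zero) zero (inj₂ refl) (inj₂ refl)
    -- The new spoke stands second among the spokes, behind that of π₁; hence the additional swap.
    (prep _ (↭-trans (prep _ (↭-reflexive old-edges)) (↭-sym (↭-trans (++⁺ˡ _ (swap _ _ Perm.refl)) (shift _ _ _)))))
    where
    old-edges : map (map² (punchIn (suc (suc zero)))) (coneCT 1 s) ≡ _
    old-edges = trans (map-++ _ (map _ (ctEdges 1 s)) _) (cong₂ _++_
      (trans (sym (map-∘ (ctEdges 1 s))) (trans (sym (map-∘ (allFin s)))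
        (trans (map-tabulate id _) (sym (trans (sym (map-∘ (List.tabulate suc))) (map-tabulate suc _))))))
      (cong ((zero , suc zero) ∷_) (trans (cong (map _) (map-tabulate suc spoke)) (trans (map-tabulate (spoke ∘ suc) _) (sym (map-tabulate (λ v → suc (suc v)) spoke))))))

  -- Closed forms for the counts, from the cone over one vertex.

  edge₀ : Fin 1 → Fin 2 × Fin 2
  edge₀ = List.lookup (coneCT 1 0)

  walk₀ : ∀ {Q : Fin 1 → Set} → Q zero → ∀ u v → Walk edge₀ Q u v
  walk₀ q zero       zero       = here
  walk₀ q zero       (suc zero) = edge zero q
  walk₀ q (suc zero) zero       = walk-sym (edge zero q)
  walk₀ q (suc zero) (suc zero) = here

  no-walk : ∀ {ends : Fin n → V × V} {Q u v} → (∀ e → ¬ Q e) → Walk ends Q u v → u ≡ v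
  no-walk ∅ here           = refl
  no-walk ∅ (step e q _ _) = ⊥-elim (∅ e q)

  single-trees : Trees (List.lookup (coneCT 1 0)) 1
  single-trees = count-∷ (count-[]
      (walk₀ refl , λ { zero _ w → case no-walk (λ { zero (_ , ne) → ne refl }) w of λ () }))
    (count-none (λ { [] (conn , _) → case no-walk (λ { zero () }) (conn zero (suc zero)) of λ () }))

  single-forests : Forests (List.lookup (coneCT 1 0)) (suc zero) zero 1
  single-forests = count-∷
    (count-none (λ { [] (_ , _ , sep) → sep (walk₀ refl _ _) }))
    (count-[] ((λ { zero () }) , (λ { zero → inj₁ here ; (suc zero) → inj₂ here }) ,
      λ w → case no-walk (λ { zero () }) w of λ ()))

  subst-count : {P : A → Set} → k ≡ l → Count P k → Count P l
  subst-count refl c = c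

  -- With G_n = s F_n + 2 F_{n+1} and s = k + 1, the counts are 2^k G_{2q+1} and 2^k G_{2q}. A path
  -- vertex replaces (T, F) by (2T + F, T + F), which is two Fibonacci steps of G. For q = 0 a leaf
  -- replaces it by (2T + F, 2F), starting from T = F = 1 without leaves.
  cone-counts : ∀ q k → let E = List.lookup (coneCT (suc q) (suc k)) in
    Trees E (2 ^ k * (suc k * fib (suc (q * 2)) + 2 * fib (suc (suc (q * 2))))) ×
    Forests E (suc zero) zero (2 ^ k * (suc k * fib (q * 2) + 2 * fib (suc (q * 2))))
  cone-counts zero zero =
    ≅-trees (addLeaf 0) (addVertex-trees single-trees single-forests) ,
    ≅-forests (addLeaf 0) (addVertex-forests-old single-trees single-forests)
  cone-counts zero (suc k) with cone-counts zero k
  ... | T , F =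
    subst-count (t-eq (2 ^ k) k) (≅-trees (addLeaf (suc k)) (addVertex-trees T F)) ,
    subst-count (f-eq (2 ^ k) k) (≅-forests (addLeaf (suc k)) (addVertex-forests-old T F))
    where
    t-eq : ∀ x k → (x * (suc k * 0 + 2) + x * (suc k * 1 + 2)) + (x * (suc k * 1 + 2) + 0) ≡ 2 * x * (suc (suc k) * 1 + 2)
    t-eq = ℕ-solver.solve-∀
    f-eq : ∀ x k → (0 + x * (suc k * 0 + 2)) + (x * (suc k * 0 + 2) + 0) ≡ 2 * x * (suc (suc k) * 0 + 2)
    f-eq = ℕ-solver.solve-∀
  cone-counts (suc q) k with cone-counts q k
  ... | T , F =
    subst-count (t-eq (2 ^ k) k (fib (q * 2)) (fib (suc (q * 2)))) (≅-trees (addPathVertex q (suc k)) (addVertex-trees T F)) ,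
    subst-count (f-eq (2 ^ k) k (fib (q * 2)) (fib (suc (q * 2)))) (≅-forests (addPathVertex q (suc k)) (addVertex-forests-new T F))
    where
    t-eq : ∀ x k a b →
      (x * (suc k * a + 2 * b) + x * (suc k * b + 2 * (b + a))) + (x * (suc k * b + 2 * (b + a)) + 0) ≡
      x * (suc k * (b + a + b) + 2 * (b + a + b + (b + a)))
    t-eq = ℕ-solver.solve-∀
    f-eq : ∀ x k a b →
      (0 + x * (suc k * a + 2 * b)) + (0 + x * (suc k * b + 2 * (b + a))) ≡
      x * (suc k * (b + a) + 2 * (b + a + b))
    f-eq = ℕ-solver.solve-∀

  -- Back to `Reach` and `IsSpanningTree`.

  module _ {V : ℕ} (E : List (Edge V)) where

    -- A general predicate `S′` lets this serve both the whole of `S` and `S` with one edge removed.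
    reach⇔walk : ∀ {S S′ u v} → (∀ e → e ∈ S → S′ e) → (∀ e → S′ e → e ∈ S) → Reach E S u v ⇔ Walk (List.lookup E) S′ u v
    reach⇔walk {S} {S′} f g = mk⇔ fwd bwd
      where
      fwd : ∀ {u v} → Reach E S u v → Walk (List.lookup E) S′ u v
      fwd here = here
      fwd (step e e∈ j r) = step e (f e e∈) (Sum.map (λ (p , q) → cong₂ _,_ p q) (λ (p , q) → cong₂ _,_ p q) j) (fwd r)
      bwd : ∀ {u v} → Walk (List.lookup E) S′ u v → Reach E S u v
      bwd here = here
      bwd (step e q j w) = step e (g e q) (Sum.map (λ p → cong proj₁ p , cong proj₂ p) (λ p → cong proj₁ p , cong proj₂ p) j) (bwd w)

    private
      ∈⇒sel : ∀ {S : EdgeSet E} e → e ∈ S → Sel S e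
      ∈⇒sel e = []=⇒lookup
      sel⇒∈ : ∀ {S : EdgeSet E} e → Sel S e → e ∈ S
      sel⇒∈ {S} e = lookup⇒[]= e S

      without⇔ : ∀ {S : EdgeSet E} {e u v} → Reach E (S ─ ⁅ e ⁆) u v ⇔ Walk (List.lookup E) (Without (Sel S) e) u v
      without⇔ {S} {e} = reach⇔walk
        (λ e′ e′∈ → ∈⇒sel e′ (p─q⊆p S ⁅ e ⁆ e′∈) , λ { refl → x∉p-x S e′∈ })
        (λ e′ (q , ne) → x∈p∧x≢y⇒x∈p-y (sel⇒∈ e′ q) ne)
        where
        x∉p-x : ∀ {n} {x} (S : Subset n) → ¬ (x ∈ S ─ ⁅ x ⁆)
        x∉p-x {x = zero}  (b ∷ S) ()
        x∉p-x {x = suc x} (b ∷ S) (there x∈) = x∉p-x S x∈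

    spanningTree⇔tree : ∀ S → Tree (List.lookup E) (Sel S) ⇔ IsSpanningTree E S
    spanningTree⇔tree S = mk⇔
      (λ (conn , acyc) → (λ u v → from whole (conn u v)) , (λ e e∈ r → acyc e (∈⇒sel e e∈) (to without⇔ r)))
      (λ (conn , acyc) → (λ u v → to whole (conn u v)) , (λ e q w → acyc e (sel⇒∈ e q) (from without⇔ w)))
      where
      whole : ∀ {u v} → Reach E S u v ⇔ Walk (List.lookup E) (Sel S) u v
      whole = reach⇔walk ∈⇒sel sel⇒∈

  numSpanningTrees : ∀ q k → NumSpanningTrees (coneCT (suc q) (suc k)) (2 ^ k * m (suc q) (suc k))
  numSpanningTrees q k = subst-count (cong (2 ^ k *_) (sym (m-fib q (suc k))))
    (count-resp (spanningTree⇔tree (coneCT (suc q) (suc k))) (proj₁ (cone-counts q k)))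

-- The sandpile group of the cone.

module Sandpile where

  open SpanningTrees using (map²; ctEdges-suc; spoke)
  open import Algebra.Morphism.Structures using (module GroupMorphisms)
  open import Data.Integer as ℤ using (ℤ; +_; -_; _+_; _-_; _*_)
  open import Data.Integer.Divisibility.Signed using (_∣_; divides; ∣⇒∣ᵤ; ∣ᵤ⇒∣; ∣m∣n⇒∣m+n; ∣m+n∣m⇒∣n; ∣m⇒∣m*n)
  open import Data.Integer.Properties using (+-identityˡ; +-identityʳ; *-zeroʳ; *-zeroˡ; *-identityˡ; i-j≡0⇒i≡j; i≡j⇒i-j≡0; neg-distrib-+; pos-*)
  open import Data.Integer.Tactic.RingSolver using (solve-∀)
  open import Data.List using (filterᵇ; tabulate)
  open import Data.Nat.DivMod using (m≡m%n+[m/n]*n)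

  private
    variable
      n k : ℕ

  -- Makes an equation usable by the ring solver: the solver proves the identity with the multiplier
  -- `c`, and `l ≡ r` makes its right side vanish.
  linear-consequence : ∀ {a b l r : ℤ} c → a - b ≡ c * (l - r) → l ≡ r → a ≡ b
  linear-consequence {a} {b} {l} {r} c eq l≡r = i-j≡0⇒i≡j a b (trans eq (trans (cong (c *_) (i≡j⇒i-j≡0 l≡r)) (*-zeroʳ c)))

  sum-linear : ∀ {n} c d {h f g : Fin n → ℤ} → (∀ i → h i ≡ c * f i + d * g i) → sumℤ h ≡ c * sumℤ f + d * sumℤ g
  sum-linear {zero}  c d eq = sym (cong₂ _+_ (*-zeroʳ c) (*-zeroʳ d))
  sum-linear {suc n} c d {h} {f} {g} eq = trans (cong₂ _+_ (eq zero) (sum-linear c d (eq ∘ suc)))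
    (regroup c d (f zero) (g zero) (sumℤ (f ∘ suc)) (sumℤ (g ∘ suc)))
    where
    regroup : ∀ c d a b x y → (c * a + d * b) + (c * x + d * y) ≡ c * (a + x) + d * (b + y)
    regroup = solve-∀

  sum-cong : ∀ {n} {f g : Fin n → ℤ} → (∀ i → f i ≡ g i) → sumℤ f ≡ sumℤ g
  sum-cong {zero}  eq = refl
  sum-cong {suc n} eq = cong₂ _+_ (eq zero) (sum-cong (eq ∘ suc))

  sum-0 : ∀ {n} {f : Fin n → ℤ} → (∀ i → f i ≡ + 0) → sumℤ f ≡ + 0
  sum-0 {zero}  eq = refl
  sum-0 {suc n} eq = cong₂ _+_ (eq zero) (sum-0 (eq ∘ suc))

  sum-const-minus : ∀ {n} c (g : Fin n → ℤ) → sumℤ (λ j → c - g j) ≡ + n * c - sumℤ g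
  sum-const-minus {zero}  c g = refl
  sum-const-minus {suc n} c g = trans (cong (λ u → c - g zero + u) (sum-const-minus c (g ∘ suc)))
    (regroup (+ n) c (g zero) (sumℤ (g ∘ suc)))
    where
    regroup : ∀ n c g s → c - g + (n * c - s) ≡ (+ 1 + n) * c - (g + s)
    regroup = solve-∀

  -- The Laplacian as a sum over edges.

  bit : Bool → ℤ
  bit b = if b then + 1 else + 0

  δ : Fin n → Fin n → ℤ
  δ a v = bit (does (a ≟ v))

  sum-δ : ∀ {n} (a : Fin n) (z : Fin n → ℤ) → sumℤ (λ v → δ a v * z v) ≡ z a
  sum-δ zero    z = trans (cong₂ _+_ (*-identityˡ (z zero)) (sum-0 (λ i → *-zeroˡ (z (suc i))))) (+-identityʳ _)
  sum-δ (suc a) z = trans (cong₂ _+_ (*-zeroˡ (z zero)) (sum-δ a (z ∘ suc))) (+-identityˡ _)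

  δ-sym : (a b : Fin n) → δ a b ≡ δ b a
  δ-sym zero    zero    = refl
  δ-sym zero    (suc b) = refl
  δ-sym (suc a) zero    = refl
  δ-sym (suc a) (suc b) = δ-sym a b

  -- An edge (a , b) contributes to the Laplacian the rank-one matrix given by the vector δ_a - δ_b
  -- times its transpose. This is entry `u` of that matrix applied to `z`; it vanishes for loops.
  flow : Edge n → (Fin n → ℤ) → Fin n → ℤ
  flow (a , b) z u = (δ a u - δ b u) * (z a - z b)

  flows : List (Edge n) → (Fin n → ℤ) → Fin n → ℤ
  flows []      z u = + 0
  flows (e ∷ E) z u = flow e z u + flows E z u

  private
    length-filterᵇ : ∀ {A : Set} (f : A → Bool) x xs →
      + length (filterᵇ f (x ∷ xs)) ≡ bit (f x) + + length (filterᵇ f xs)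
    length-filterᵇ f x xs with f x
    ... | true  = refl
    ... | false = refl

    Laplacian-∷ : (e : Edge n) (E : List (Edge n)) → ∀ u v →
      Laplacian (e ∷ E) u v ≡ (δ (proj₁ e) u - δ (proj₂ e) u) * (δ (proj₁ e) v - δ (proj₂ e) v) + Laplacian E u v
    Laplacian-∷ e@(a , b) E u v with u ≟ v
    ... | yes refl = trans (length-filterᵇ (λ (a , b) → ⌊ a ≟ u ⌋ xor ⌊ b ≟ u ⌋) e E) (cong (_+ + deg E u) diag)
      where
      diag : bit (⌊ a ≟ u ⌋ xor ⌊ b ≟ u ⌋) ≡ (δ a u - δ b u) * (δ a u - δ b u)
      diag with a ≟ u | b ≟ u
      ... | yes _ | yes _ = refl
      ... | yes _ | no _  = refl
      ... | no _  | yes _ = refl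
      ... | no _  | no _  = refl
    ... | no u≢v = trans
      (cong -_ (length-filterᵇ (λ (a , b) → (⌊ a ≟ u ⌋ ∧ ⌊ b ≟ v ⌋) ∨ (⌊ a ≟ v ⌋ ∧ ⌊ b ≟ u ⌋)) e E))
      (trans (neg-distrib-+ (bit ((⌊ a ≟ u ⌋ ∧ ⌊ b ≟ v ⌋) ∨ (⌊ a ≟ v ⌋ ∧ ⌊ b ≟ u ⌋))) (+ mult E u v)) (cong (_+ - (+ mult E u v)) off))
      where
      off : - bit ((⌊ a ≟ u ⌋ ∧ ⌊ b ≟ v ⌋) ∨ (⌊ a ≟ v ⌋ ∧ ⌊ b ≟ u ⌋)) ≡ (δ a u - δ b u) * (δ a v - δ b v)
      off with a ≟ u | a ≟ v | b ≟ u | b ≟ v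
      -- No end of the edge can be both `u` and `v`.
      ... | yes a≡u | yes a≡v | _       | _       = ⊥-elim (u≢v (trans (sym a≡u) a≡v))
      ... | _       | _       | yes b≡u | yes b≡v = ⊥-elim (u≢v (trans (sym b≡u) b≡v))
      ... | yes _   | no _    | yes _   | no _    = refl
      ... | yes _   | no _    | no _    | yes _   = refl
      ... | yes _   | no _    | no _    | no _    = refl
      ... | no _    | yes _   | yes _   | no _    = refl
      ... | no _    | yes _   | no _    | yes _   = refl
      ... | no _    | yes _   | no _    | no _    = refl
      ... | no _    | no _    | yes _   | no _    = refl
      ... | no _    | no _    | no _    | yes _   = refl
      ... | no _    | no _    | no _    | no _    = refl

  Laplacian-flows : (E : List (Edge n)) → ∀ z u → sumℤ (λ v → Laplacian E u v * z v) ≡ flows E z u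
  Laplacian-flows [] z u = sum-0 zeros
    where
    zeros : ∀ v → Laplacian [] u v * z v ≡ + 0
    zeros v with u ≟ v
    ... | yes _ = *-zeroˡ (z v)
    ... | no _  = *-zeroˡ (z v)
  Laplacian-flows (e@(a , b) ∷ E) z u = trans
    (sum-linear (δ a u - δ b u) (+ 1) (λ v → trans (cong (_* z v) (Laplacian-∷ e E u v))
      (expand (δ a u - δ b u) (δ a v) (δ b v) (Laplacian E u v) (z v))))
    (cong₂ _+_
      (cong ((δ a u - δ b u) *_) (trans
        (sum-linear (+ 1) (- + 1) {f = λ v → δ a v * z v} {g = λ v → δ b v * z v} (λ v → refl))
        (trans (collect (sumℤ (λ v → δ a v * z v)) (sumℤ (λ v → δ b v * z v))) (cong₂ _-_ (sum-δ a z) (sum-δ b z)))))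
      (trans (*-identityˡ _) (Laplacian-flows E z u)))
    where
    expand : ∀ c a b l z → (c * (a - b) + l) * z ≡ c * (+ 1 * (a * z) + - + 1 * (b * z)) + + 1 * (l * z)
    expand = solve-∀
    collect : ∀ a b → + 1 * a + - + 1 * b ≡ a - b
    collect = solve-∀

  flows-++ : (E F : List (Edge n)) → ∀ z u → flows (E ++ F) z u ≡ flows E z u + flows F z u
  flows-++ []      F z u = sym (+-identityˡ _)
  flows-++ (e ∷ E) F z u = trans (cong (λ x → flow e z u + x) (flows-++ E F z u))
    (assoc (flow e z u) (flows E z u) (flows F z u))
    where
    assoc : ∀ a b c → a + (b + c) ≡ (a + b) + c
    assoc = solve-∀

  flows-tabulate : (h : Fin k → Edge n) → ∀ z u → flows (tabulate h) z u ≡ sumℤ (λ j → flow (h j) z u)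
  flows-tabulate {zero}  h z u = refl
  flows-tabulate {suc k} h z u = cong (λ x → flow (h zero) z u + x) (flows-tabulate (h ∘ suc) z u)

  flows-map-suc : {f : Edge n → Edge (suc n)} → (∀ e → f e ≡ map² suc e) → ∀ E z i →
    flows (map f E) z (suc i) ≡ flows E (z ∘ suc) i
  flows-map-suc f≡ []      z i = refl
  flows-map-suc f≡ (e ∷ E) z i = cong₂ _+_ (cong (λ e → flow e z (suc i)) (f≡ e)) (flows-map-suc f≡ E z i)

  flows-map-zero : {f : Edge n → Edge (suc n)} → (∀ e → f e ≡ map² suc e) → ∀ E z →
    flows (map f E) z zero ≡ + 0
  flows-map-zero f≡ []      z = refl
  flows-map-zero f≡ (e ∷ E) z = cong₂ _+_ (trans (cong (λ e → flow e z zero) (f≡ e)) (*-zeroˡ (z (suc (proj₁ e)) - z (suc (proj₂ e))))) (flows-map-zero f≡ E z)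

  -- Extending `z` by 0 at the root makes the deleted column contribute nothing. The spokes then add
  -- the identity matrix to the Laplacian of the tree.
  reducedLaplacian-coneEdges : (E : List (Edge n)) → ∀ z i →
    (reducedLaplacian (coneEdges E) · z) i ≡ flows E z i + z i
  reducedLaplacian-coneEdges {n} E z i = trans (sym drop-root)
    (trans (Laplacian-flows (coneEdges E) ẑ (suc i))
    (trans (flows-++ (map _ E) _ ẑ (suc i))
    (cong₂ _+_ (flows-map-suc (λ _ → refl) E ẑ i) spokes)))
    where
    ẑ : Fin (suc n) → ℤ
    ẑ zero    = + 0
    ẑ (suc j) = z j
    drop-root : sumℤ (λ v → Laplacian (coneEdges E) (suc i) v * ẑ v) ≡ (reducedLaplacian (coneEdges E) · z) i
    drop-root = trans (cong (_+ (reducedLaplacian (coneEdges E) · z) i) (*-zeroʳ (Laplacian (coneEdges E) (suc i) zero))) (+-identityˡ _)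
    spokes : flows (map spoke (allFin n)) ẑ (suc i) ≡ z i
    spokes = trans (cong (λ E → flows E ẑ (suc i)) (map-tabulate id spoke))
      (trans (flows-tabulate spoke ẑ (suc i))
      (trans (sum-cong (λ j → trans (drop (δ j i) (z j)) (cong (_* z j) (δ-sym j i)))) (sum-δ i z)))
      where
      drop : ∀ d z → (+ 0 - d) * (+ 0 - z) ≡ d * z
      drop = solve-∀

  private
    ray : ∀ {s} → Fin s → Edge (1 ℕ.+ s)
    ray j = zero , suc j

    star-centre : ∀ s z → flows (ctEdges 1 s) z zero ≡ sumℤ (λ (j : Fin s) → z zero - z (suc j))
    star-centre s z = trans (cong (λ E → flows E z zero) (map-tabulate id ray))
      (trans (flows-tabulate ray z zero) (sum-cong (λ j → unit (z zero - z (suc j)))))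
      where
      unit : ∀ x → (+ 1 - + 0) * x ≡ x
      unit = solve-∀

    star-leaf : ∀ s z (i : Fin s) → flows (ctEdges 1 s) z (suc i) ≡ z (suc i) - z zero
    star-leaf s z i = trans (cong (λ E → flows E z (suc i)) (map-tabulate id ray))
      (trans (flows-tabulate ray z (suc i))
      (trans (sum-cong (λ j → trans (cong (λ d → (+ 0 - d) * (z zero - z (suc j))) (δ-sym j i)) (flip (δ i j) (z zero) (z (suc j)))))
        (sum-δ i (λ j → z (suc j) - z zero))))
      where
      flip : ∀ d a b → (+ 0 - d) * (a - b) ≡ d * (b - a)
      flip = solve-∀

    ct-flows : ∀ q s z → let E = ctEdges (suc q) s; flow⁺ = flows (ctEdges (suc (suc q)) s) z in
      (flow⁺ zero ≡ z zero - z (suc zero)) ×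
      (flow⁺ (suc zero) ≡ z (suc zero) - z zero + flows E (z ∘ suc) zero) ×
      (∀ i → flow⁺ (suc (suc i)) ≡ flows E (z ∘ suc) (suc i))
    ct-flows q s z =
      trans (split zero) (trans (cong (λ f → flow (zero , suc zero) z zero + f) (flows-map-zero (λ _ → refl) E z)) (at-0 (z zero) (z (suc zero)))) ,
      trans (split (suc zero)) (cong₂ _+_ (at-1 (z zero) (z (suc zero))) (flows-map-suc (λ _ → refl) E z zero)) ,
      (λ i → trans (split (suc (suc i))) (trans (+-identityˡ _) (flows-map-suc (λ _ → refl) E z (suc i))))
      where
      E = ctEdges (suc q) s
      split : ∀ i → flows (ctEdges (suc (suc q)) s) z i ≡ flow (zero , suc zero) z i + flows (map (map² suc) E) z i
      split i = cong (λ E → flows E z i) (ctEdges-suc q s)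
      at-0 : ∀ a b → (+ 1 - + 0) * (a - b) + + 0 ≡ a - b
      at-0 = solve-∀
      at-1 : ∀ a b → (+ 0 - + 1) * (a - b) ≡ b - a
      at-1 = solve-∀

  -- Elimination along the path.

  bump : ℤ → (Fin (suc n) → ℤ) → Fin (suc n) → ℤ
  bump a z zero    = z zero - a
  bump a z (suc _) = + 0

  -- The rows of the equation L̄ z = x, with an extra neighbour of value a attached
  -- to the first path vertex; a = z zero gives the original system.
  Rows : ∀ q {s} → ℤ → (z x : Fin (suc q ℕ.+ s) → ℤ) → Set
  Rows q {s} a z x = ∀ i → flows (ctEdges (suc q) s) z i + z i + bump a z i ≡ x i

  rows⇔fires : ∀ q {s} (z x : Fin (suc q ℕ.+ s) → ℤ) →
    Rows q (z zero) z x ⇔ (∀ i → x i ≡ (reducedLaplacian (coneCT (suc q) s) · z) i)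
  rows⇔fires q {s} z x = mk⇔ (λ rows i → trans (sym (rows i)) (agree i)) (λ fires i → trans (agree i) (sym (fires i)))
    where
    E = ctEdges (suc q) s
    unbumped : ∀ i → bump (z zero) z i ≡ + 0
    unbumped zero    = i≡j⇒i-j≡0 {z zero} refl
    unbumped (suc i) = refl
    agree : ∀ i → flows E z i + z i + bump (z zero) z i ≡ (reducedLaplacian (coneEdges E) · z) i
    agree i = trans (cong (λ u → flows E z i + z i + u) (unbumped i))
      (trans (+-identityʳ _) (sym (reducedLaplacian-coneEdges E z i)))

  leaf : ∀ q {s} → Fin s → Fin (suc q ℕ.+ s)
  leaf q j = suc q ↑ʳ j

  -- The path rows of L̄ z = x say z (i + 1) = 3 z i - z (i - 1) - x i: the value of
  -- this recurrence, started from a , b, at the last path vertex and one step further.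
  last next : ∀ q {s} → (Fin (suc q ℕ.+ s) → ℤ) → ℤ → ℤ → ℤ
  last zero    x a b = b
  last (suc q) x a b = last q (x ∘ suc) b (+ 3 * b - a - x zero)
  next zero    x a b = + 3 * b - a - x zero
  next (suc q) x a b = next q (x ∘ suc) b (+ 3 * b - a - x zero)

  -- `P` is the value at π_p and `N` the value that one more path vertex would need. The leaves take
  -- the place of that vertex in the row of π_p, so their terms `P - w j` must add up to P - N.
  LeafRows : ∀ q {s} → ℤ → ℤ → (Fin s → ℤ) → (Fin (suc q ℕ.+ s) → ℤ) → Set
  LeafRows q P N w x = (N + sumℤ (λ j → P - w j) ≡ P) × (∀ j → + 2 * w j - P ≡ x (leaf q j))

  -- The row of π₁ determines the value at π₂. The other rows form the same system for the tree
  -- without π₁, with `z zero` as the extra neighbour, which is the reason for the parameter `a`.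
  rows⇒leafRows : ∀ q {s} a z (x : Fin (suc q ℕ.+ s) → ℤ) → Rows q a z x →
    LeafRows q (last q x a (z zero)) (next q x a (z zero)) (z ∘ leaf q) x
  rows⇒leafRows zero {s} a z x rows =
    linear-consequence (+ 1) (centre (sumℤ (λ j → z zero - z (suc j))) (z zero) a (x zero))
      (trans (cong (λ f → f + z zero + (z zero - a)) (sym (star-centre s z))) (rows zero)) ,
    (λ j → trans (outer (z (suc j)) (z zero)) (trans (cong (λ f → f + z (suc j) + + 0) (sym (star-leaf s z j))) (rows (suc j))))
    where
    centre : ∀ S b a x → + 3 * b - a - x + S - b ≡ + 1 * (S + b + (b - a) - x)
    centre = solve-∀
    outer : ∀ w b → + 2 * w - b ≡ w - b + w + + 0
    outer = solve-∀
  rows⇒leafRows (suc q) {s} a z x rows = subst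
    (λ b → LeafRows q (last q (x ∘ suc) (z zero) b) (next q (x ∘ suc) (z zero) b) (z ∘ leaf (suc q)) (x ∘ suc)) next-value
    (rows⇒leafRows q (z zero) (z ∘ suc) (x ∘ suc) rows′)
    where
    shape = ct-flows q s z
    next-value : z (suc zero) ≡ + 3 * z zero - a - x zero
    next-value = linear-consequence (- + 1) (solved (z zero) (z (suc zero)) a (x zero))
      (trans (cong (λ f → f + z zero + (z zero - a)) (sym (proj₁ shape))) (rows zero))
      where
      solved : ∀ b c a x → c - (+ 3 * b - a - x) ≡ (- + 1) * (b - c + b + (b - a) - x)
      solved = solve-∀
    rows′ : Rows q (z zero) (z ∘ suc) (x ∘ suc)
    rows′ zero = trans (moved (flows (ctEdges (suc q) s) (z ∘ suc) zero) (z zero) (z (suc zero)))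
      (trans (cong (λ f → f + z (suc zero) + + 0) (sym (proj₁ (proj₂ shape)))) (rows (suc zero)))
      where
      moved : ∀ f b c → f + c + (c - b) ≡ c - b + f + c + + 0
      moved = solve-∀
    rows′ (suc i) = trans (cong (λ f → f + z (suc (suc i)) + + 0) (sym (proj₂ (proj₂ shape) i))) (rows (suc (suc i)))

  solution : ∀ q {s} → (Fin (suc q ℕ.+ s) → ℤ) → ℤ → ℤ → (Fin s → ℤ) → Fin (suc q ℕ.+ s) → ℤ
  solution q       x a b w zero    = b
  solution zero    x a b w (suc j) = w j
  solution (suc q) x a b w (suc i) = solution q (x ∘ suc) b (+ 3 * b - a - x zero) w i

  leafRows⇒rows : ∀ q {s} a b w (x : Fin (suc q ℕ.+ s) → ℤ) →
    LeafRows q (last q x a b) (next q x a b) w x → Rows q a (solution q x a b w) x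
  leafRows⇒rows zero {s} a b w x (centre-row , leaf-row) zero =
    trans (cong (λ f → f + b + (b - a)) (star-centre s (solution zero x a b w)))
      (linear-consequence (+ 1) (centre (sumℤ (λ j → b - w j)) b a (x zero)) centre-row)
    where
    centre : ∀ S b a x → S + b + (b - a) - x ≡ + 1 * (+ 3 * b - a - x + S - b)
    centre = solve-∀
  leafRows⇒rows zero {s} a b w x (centre-row , leaf-row) (suc j) =
    trans (cong (λ f → f + w j + + 0) (star-leaf s (solution zero x a b w) j)) (trans (outer (w j) b) (leaf-row j))
    where
    outer : ∀ w b → w - b + w + + 0 ≡ + 2 * w - b
    outer = solve-∀
  leafRows⇒rows (suc q) {s} a b w x leafRows = rows
    where
    c = + 3 * b - a - x zero
    z = solution (suc q) x a b w
    shape = ct-flows q s z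
    rows′ : Rows q b (z ∘ suc) (x ∘ suc)
    rows′ = leafRows⇒rows q b c w (x ∘ suc) leafRows
    rows : Rows (suc q) a z x
    rows zero = trans (cong (λ f → f + b + (b - a)) (proj₁ shape)) (solved b a (x zero))
      where
      solved : ∀ b a x → b - (+ 3 * b - a - x) + b + (b - a) ≡ x
      solved = solve-∀
    rows (suc zero) = trans (cong (λ f → f + z (suc zero) + + 0) (proj₁ (proj₂ shape)))
      (trans (moved (flows (ctEdges (suc q) s) (z ∘ suc) zero) b (z (suc zero))) (rows′ zero))
      where
      moved : ∀ f b c → c - b + f + c + + 0 ≡ f + c + (c - b)
      moved = solve-∀
    rows (suc (suc i)) = trans (cong (λ f → f + z (suc (suc i)) + + 0) (proj₂ (proj₂ shape) i)) (rows′ (suc i))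

  -- The pointwise premise includes that `g` respects pointwise equality of vectors. Suitable `c`
  -- and `d` give sums, differences, negatives and zero.
  Linear : ((Fin n → ℤ) → ℤ) → Set
  Linear g = ∀ c d {w x y} → (∀ i → w i ≡ c * x i + d * y i) → g w ≡ c * g x + d * g y

  linear-minus : {g : (Fin n → ℤ) → ℤ} → Linear g → ∀ x y → g (λ i → x i - y i) ≡ g x - g y
  linear-minus {g = g} lin x y = trans (lin (+ 1) (- + 1) (λ i → split (x i) (y i))) (sym (split (g x) (g y)))
    where
    split : ∀ a b → a - b ≡ + 1 * a + - + 1 * b
    split = solve-∀

  linear-plus : {g : (Fin n → ℤ) → ℤ} → Linear g → ∀ x y → g (λ i → x i + y i) ≡ g x + g y
  linear-plus {g = g} lin x y = trans (lin (+ 1) (+ 1) (λ i → split (x i) (y i))) (sym (split (g x) (g y)))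
    where
    split : ∀ a b → a + b ≡ + 1 * a + + 1 * b
    split = solve-∀

  linear-neg : {g : (Fin n → ℤ) → ℤ} → Linear g → ∀ x → g (λ i → - x i) ≡ - g x
  linear-neg {g = g} lin x = trans (lin (- + 1) (+ 0) {y = x} (λ i → split (x i))) (sym (split (g x)))
    where
    split : ∀ a → - a ≡ - + 1 * a + + 0 * a
    split = solve-∀

  linear-zero : {g : (Fin n → ℤ) → ℤ} → Linear g → g (λ _ → + 0) ≡ + 0
  linear-zero {g = g} lin = trans (lin (+ 0) (+ 0) {x = λ _ → + 0} {y = λ _ → + 0} (λ _ → refl)) (vanish (g (λ _ → + 0)))
    where
    vanish : ∀ a → + 0 * a + + 0 * a ≡ + 0
    vanish = solve-∀

  -- Homomorphisms onto sums of cyclic groups.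

  twosAnd : ℕ → ℕ → List ℕ
  twosAnd k d = replicate k 2 ++ (d ∷ [])

  place : ∀ k {d} → (Fin k → ℤ) → ℤ → Fin (length (twosAnd k d)) → ℤ
  place zero    t r zero    = r
  place (suc k) t r zero    = t zero
  place (suc k) t r (suc i) = place k (t ∘ suc) r i

  place-linear : ∀ k {d} {t : (Fin n → ℤ) → Fin k → ℤ} {r} → (∀ j → Linear (λ x → t x j)) → Linear r →
    ∀ i → Linear (λ x → place k {d} (t x) (r x) i)
  place-linear zero    lin-t lin-r zero    = lin-r
  place-linear (suc k) lin-t lin-r zero    = lin-t zero
  place-linear (suc k) lin-t lin-r (suc i) = place-linear k (lin-t ∘ suc) lin-r i

  place-divides : ∀ k {d} {t : Fin k → ℤ} {r} →
    ((∀ j → + 2 ∣ t j) × + d ∣ r) ⇔ (∀ i → + List.lookup (twosAnd k d) i ∣ place k t r i)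
  place-divides k = mk⇔ (λ (p , q) → fwd k p q) (λ p → bwd₁ k p , bwd₂ k p)
    where
    fwd : ∀ k {d} {t : Fin k → ℤ} {r} → (∀ j → + 2 ∣ t j) → + d ∣ r → ∀ i → + List.lookup (twosAnd k d) i ∣ place k t r i
    fwd zero    p q zero    = q
    fwd (suc k) p q zero    = p zero
    fwd (suc k) p q (suc i) = fwd k (p ∘ suc) q i
    bwd₁ : ∀ k {d} {t : Fin k → ℤ} {r} → (∀ i → + List.lookup (twosAnd k d) i ∣ place k t r i) → ∀ j → + 2 ∣ t j
    bwd₁ (suc k) p zero    = p zero
    bwd₁ (suc k) p (suc j) = bwd₁ k (p ∘ suc) j
    bwd₂ : ∀ k {d} {t : Fin k → ℤ} {r} → (∀ i → + List.lookup (twosAnd k d) i ∣ place k t r i) → + d ∣ r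
    bwd₂ zero    p = p zero
    bwd₂ (suc k) p = bwd₂ k (p ∘ suc)

  place-surjective : ∀ k {d} (y : Fin (length (twosAnd k d)) → ℤ) → ∃ λ t → ∃ λ r → ∀ i → place k t r i ≡ y i
  place-surjective zero y = (λ ()) , y zero , λ { zero → refl }
  place-surjective (suc k) y with place-surjective k (y ∘ suc)
  ... | t , r , eq = (λ { zero → y zero ; (suc j) → t j }) , r , λ { zero → refl ; (suc i) → eq i }

  place-cong : ∀ k {d} {t t′ : Fin k → ℤ} {r r′} → (∀ j → t j ≡ t′ j) → r ≡ r′ → ∀ i → place k {d} t r i ≡ place k t′ r′ i
  place-cong zero    p q zero    = q
  place-cong (suc k) p q zero    = p zero
  place-cong (suc k) p q (suc i) = place-cong k (p ∘ suc) q i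

  -- `x ≈ y` in `SandpileGroup E` unfolds to `Firable E (λ i → x i - y i)`.
  Firable : List (Edge (suc n)) → (Fin n → ℤ) → Set
  Firable E x = ∃ λ z → ∀ i → x i ≡ (reducedLaplacian E · z) i

  -- The first isomorphism theorem for the map with coordinates `t` and `r`. The two directions of
  -- `kernel` give well-definedness and injectivity, and integral preimages give surjectivity.
  sandpileIso : (E : List (Edge (suc n))) → ∀ k d (t : (Fin n → ℤ) → Fin k → ℤ) (r : (Fin n → ℤ) → ℤ) →
    (∀ j → Linear (λ x → t x j)) → Linear r →
    (∀ x → Firable E x ⇔ ((∀ j → + 2 ∣ t x j) × + d ∣ r x)) →
    (∀ t′ r′ → ∃ λ x → (∀ j → t x j ≡ t′ j) × r x ≡ r′) →
    SandpileIso E (twosAnd k d)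
  sandpileIso {n} E k d t r lin-t lin-r kernel onto = f , record
    { isGroupMonomorphism = record
      { isGroupHomomorphism = record
        { isMonoidHomomorphism = record
          { isMagmaHomomorphism = record
            { isRelHomomorphism = record { cong = f-cong }
            ; homo = λ x y i → ≡⇒∣ i (linear-plus (lin i) x y)
            }
          ; ε-homo = λ i → ≡⇒∣ i (linear-zero (lin i))
          }
        ; ⁻¹-homo = λ x i → ≡⇒∣ i (linear-neg (lin i) x)
        }
      ; injective = λ {x} {y} fx≈fy → from (kernel (λ i → x i - y i)) (from (place-divides k)
          (λ i → subst (+ List.lookup (twosAnd k d) i ∣_) (sym (linear-minus (lin i) x y)) (∣ᵤ⇒∣ (fx≈fy i))))
      }
    ; surjective = λ y → let (t′ , r′ , placed) = place-surjective k y
                             (x , tx≡t′ , rx≡r′) = onto t′ r′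
                         in x , λ {z} z≈x i → subst (λ c → + List.lookup (twosAnd k d) i ℤ∣ f z i - c) (trans (place-cong k tx≡t′ rx≡r′ i) (placed i)) (f-cong z≈x i)
    }
    where
    open import Data.Integer.Divisibility using () renaming (_∣_ to _ℤ∣_)
    f : (Fin n → ℤ) → Fin (length (twosAnd k d)) → ℤ
    f x = place k (t x) (r x)
    lin : ∀ i → Linear (λ x → f x i)
    lin = place-linear k lin-t lin-r
    ≡⇒∣ : ∀ i {a b} → a ≡ b → + List.lookup (twosAnd k d) i ℤ∣ a - b
    ≡⇒∣ i {a} a≡b = ∣⇒∣ᵤ {+ List.lookup (twosAnd k d) i} (divides (+ 0) (trans (i≡j⇒i-j≡0 a≡b) (sym (*-zeroˡ (+ List.lookup (twosAnd k d) i)))))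
    f-cong : ∀ {x y} → Firable E (λ i → x i - y i) → ∀ i → + List.lookup (twosAnd k d) i ℤ∣ f x i - f y i
    f-cong {x} {y} fire i = ∣⇒∣ᵤ {+ List.lookup (twosAnd k d) i} (subst (_ ∣_) (linear-minus (lin i) x y) (to (place-divides k) (to (kernel (λ i → x i - y i)) fire) i))

  -- Fibonacci coefficients of the recurrence.

  F : ℕ → ℤ
  F n = + fib n

  -- The contributions of `x` to `last` and `next`, the rest being linear in the starting values.
  drift drift′ : ∀ q {s} → (Fin (suc q ℕ.+ s) → ℤ) → ℤ
  drift  zero    x = + 0
  drift  (suc q) x = drift q (x ∘ suc) - F (suc (suc (q ℕ.* 2))) * x zero
  drift′ zero    x = - x zero
  drift′ (suc q) x = drift′ q (x ∘ suc) - F (suc (suc (suc (suc (q ℕ.* 2))))) * x zero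

  -- Every second Fibonacci number satisfies F_{n+2} = 3 F_n - F_{n-2}, the homogeneous recurrence
  -- of the path. For a = b the coefficients combine to F_{2q+1}.
  last-affine : ∀ q {s} (x : Fin (suc q ℕ.+ s) → ℤ) a b →
    last q x a b ≡ F (suc (suc (q ℕ.* 2))) * b - F (q ℕ.* 2) * a + drift q x
  last-affine zero x a b = solved a b
    where
    solved : ∀ a b → b ≡ + 1 * b - + 0 * a + + 0
    solved = solve-∀
  last-affine (suc q) x a b = trans (last-affine q (x ∘ suc) b (+ 3 * b - a - x zero))
    (solved (F (q ℕ.* 2)) (F (suc (q ℕ.* 2))) a b (x zero) (drift q (x ∘ suc)))
    where
    solved : ∀ f g a b x d → (g + f) * (+ 3 * b - a - x) - f * b + d ≡ (g + f + g + (g + f)) * b - (g + f) * a + (d - (g + f) * x)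
    solved = solve-∀

  next-affine : ∀ q {s} (x : Fin (suc q ℕ.+ s) → ℤ) a b →
    next q x a b ≡ F (suc (suc (suc (suc (q ℕ.* 2))))) * b - F (suc (suc (q ℕ.* 2))) * a + drift′ q x
  next-affine zero x a b = solved a b (x zero)
    where
    solved : ∀ a b x → + 3 * b - a - x ≡ + 3 * b - + 1 * a + - x
    solved = solve-∀
  next-affine (suc q) x a b = trans (next-affine q (x ∘ suc) b (+ 3 * b - a - x zero))
    (solved (F (q ℕ.* 2)) (F (suc (q ℕ.* 2))) a b (x zero) (drift′ q (x ∘ suc)))
    where
    solved : ∀ f g a b x d → let h = g + f + g + (g + f) in
      h * (+ 3 * b - a - x) - (g + f) * b + d ≡ (h + (g + f + g) + h) * b - h * a + (d - h * x)
    solved = solve-∀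

  linear-drift : ∀ q {s} → Linear (drift q {s})
  linear-drift zero    c d eq = zeros c d
    where
    zeros : ∀ c d → + 0 ≡ c * + 0 + d * + 0
    zeros = solve-∀
  linear-drift (suc q) c d {w} {x} {y} eq = trans
    (cong₂ (λ u v → u - F (suc (suc (q ℕ.* 2))) * v) (linear-drift q c d (eq ∘ suc)) (eq zero))
    (regroup c d (drift q (x ∘ suc)) (drift q (y ∘ suc)) (F (suc (suc (q ℕ.* 2)))) (x zero) (y zero))
    where
    regroup : ∀ c d u v f x y → c * u + d * v - f * (c * x + d * y) ≡ c * (u - f * x) + d * (v - f * y)
    regroup = solve-∀

  linear-drift′ : ∀ q {s} → Linear (drift′ q {s})
  linear-drift′ zero    c d {w} {x} {y} eq = trans (cong -_ (eq zero)) (regroup c d (x zero) (y zero))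
    where
    regroup : ∀ c d x y → - (c * x + d * y) ≡ c * - x + d * - y
    regroup = solve-∀
  linear-drift′ (suc q) c d {w} {x} {y} eq = trans
    (cong₂ (λ u v → u - F (suc (suc (suc (suc (q ℕ.* 2))))) * v) (linear-drift′ q c d (eq ∘ suc)) (eq zero))
    (regroup c d (drift′ q (x ∘ suc)) (drift′ q (y ∘ suc)) (F (suc (suc (suc (suc (q ℕ.* 2)))))) (x zero) (y zero))
    where
    regroup : ∀ c d u v f x y → c * u + d * v - f * (c * x + d * y) ≡ c * (u - f * x) + d * (v - f * y)
    regroup = solve-∀

  leafSum : ∀ q {s} → (Fin (suc q ℕ.+ s) → ℤ) → ℤ
  leafSum q x = sumℤ (x ∘ leaf q)

  -- Eliminating the leaves from L̄ z = x leaves the single equation m · z zero = total x.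
  total : ∀ q {k} → (Fin (suc q ℕ.+ suc k) → ℤ) → ℤ
  total q {k} x = leafSum q x + (+ 1 - + k) * drift q x - + 2 * drift′ q x

  linear-total : ∀ q {k} → Linear (total q {k})
  linear-total q {k} c d {w} {x} {y} eq = trans
    (cong₂ (λ u v → u - + 2 * v)
      (cong₂ (λ u v → u + (+ 1 - + k) * v) (sum-linear c d (eq ∘ leaf q)) (linear-drift q c d eq))
      (linear-drift′ q c d eq))
    (regroup c d (leafSum q x) (leafSum q y) (+ 1 - + k) (drift q x) (drift q y) (drift′ q x) (drift′ q y))
    where
    regroup : ∀ c d s t e u v u′ v′ → c * s + d * t + e * (c * u + d * v) - + 2 * (c * u′ + d * v′) ≡
      c * (s + e * u - + 2 * u′) + d * (t + e * v - + 2 * v′)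
    regroup = solve-∀

  -- When `x` lies in the image of L̄.

  module Criterion (q k : ℕ) where
    private
      f = F (q ℕ.* 2)
      A = F (suc (q ℕ.* 2))

    M : ℤ
    M = + suc k * F (suc (q ℕ.* 2)) + + 2 * F (suc (suc (q ℕ.* 2)))

    Solvable : (Fin (suc q ℕ.+ suc k) → ℤ) → Set
    Solvable x = ∃ λ b → M * b ≡ total q x ×
      (∀ j → + 2 ∣ x (leaf q (suc j)) + F (suc (q ℕ.* 2)) * b + drift q x)

    module _ (x : Fin (suc q ℕ.+ suc k) → ℤ) (b : ℤ) where
      P N : ℤ
      P = last q x b b
      N = next q x b b

      P-eq : P ≡ A * b + drift q x
      P-eq = trans (last-affine q x b b) (solved f A b (drift q x))
        where
        solved : ∀ f g b d → (g + f) * b - f * b + d ≡ g * b + d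
        solved = solve-∀

      N-eq : N ≡ (A + (A + f)) * b + drift′ q x
      N-eq = trans (next-affine q x b b) (solved f A b (drift′ q x))
        where
        solved : ∀ f g b d → (g + f + g + (g + f)) * b - (g + f) * b + d ≡ (g + (g + f)) * b + d
        solved = solve-∀

      -- A leaf row reads 2 (P - w j) = P - g j; summing the doubled terms avoids a division by 2.
      doubled-sum : ∀ {n} (w g : Fin n → ℤ) → (∀ j → + 2 * w j - P ≡ g j) → + 2 * sumℤ (λ j → P - w j) ≡ + n * P - sumℤ g
      doubled-sum {n} w g eq = trans
        (trans (pad (sumℤ (λ j → P - w j)))
          (sym (sum-linear {n} (+ 2) (+ 0) {h = λ j → P - g j} {f = λ j → P - w j} {g = λ j → P - w j}
            (λ j → trans (cong (λ u → P - u) (sym (eq j))) (unfold P (w j))))))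
        (sum-const-minus P g)
        where
        pad : ∀ s → + 2 * s ≡ + 2 * s + + 0 * s
        pad = solve-∀
        unfold : ∀ P w → P - (+ 2 * w - P) ≡ + 2 * (P - w) + + 0 * (P - w)
        unfold = solve-∀

      -- The right side is twice the defect N + Σ (P - w j) - P of the row of π_p, after Σ 2 (P - w
      -- j) is replaced by (k + 1) P - `leafSum q x`.
      balance : M * b - total q x ≡ + 2 * N + + k * P - P - leafSum q x
      balance = trans (solved f A b (+ k) (drift q x) (drift′ q x) (leafSum q x))
        (sym (cong₂ (λ u v → + 2 * u + + k * v - v - leafSum q x) N-eq P-eq))
        where
        solved : ∀ f A b k d d′ s → ((+ 1 + k) * A + + 2 * (A + f)) * b - (s + (+ 1 - k) * d - + 2 * d′) ≡
          + 2 * ((A + (A + f)) * b + d′) + k * (A * b + d) - (A * b + d) - s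
        solved = solve-∀

    firable⇒solvable : ∀ x → Firable (coneCT (suc q) (suc k)) x → Solvable x
    firable⇒solvable x (z , fires) = b , i-j≡0⇒i≡j _ _ (trans (balance x b) zero-balance) , halves
      where
      b = z zero
      w = z ∘ leaf q
      leafRows = rows⇒leafRows q b z x (from (rows⇔fires q z x) fires)
      zero-balance : + 2 * N x b + + k * P x b - P x b - leafSum q x ≡ + 0
      zero-balance = trans
        (regroup (N x b) (+ k) (P x b) (leafSum q x))
        (trans (cong (λ u → + 2 * N x b + u - + 2 * P x b) (sym (doubled-sum x b w (x ∘ leaf q) (proj₂ leafRows))))
        (trans (factor (N x b) (sumℤ (λ j → P x b - w j)) (P x b))
        (trans (cong (λ u → + 2 * (u - P x b)) (proj₁ leafRows)) (cancel (P x b)))))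
        where
        regroup : ∀ N k P s → + 2 * N + k * P - P - s ≡ + 2 * N + ((+ 1 + k) * P - s) - + 2 * P
        regroup = solve-∀
        factor : ∀ N S P → + 2 * N + + 2 * S - + 2 * P ≡ + 2 * (N + S - P)
        factor = solve-∀
        cancel : ∀ P → + 2 * (P - P) ≡ + 0
        cancel = solve-∀
      halves : ∀ j → + 2 ∣ x (leaf q (suc j)) + F (suc (q ℕ.* 2)) * b + drift q x
      halves j = divides (w (suc j)) (trans
        (cong (λ u → u + A * b + drift q x) (sym (proj₂ leafRows (suc j))))
        (trans (cong (λ u → + 2 * w (suc j) - u + A * b + drift q x) (P-eq x b)) (solved (w (suc j)) (A * b) (drift q x))))
        where
        solved : ∀ w c d → + 2 * w - (c + d) + c + d ≡ w * + 2
        solved = solve-∀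

    solvable⇒firable : ∀ x → Solvable x → Firable (coneCT (suc q) (suc k)) x
    solvable⇒firable x (b , Mb≡total , halves) =
      solution q x b b w , to (rows⇔fires q (solution q x b b w) x) (leafRows⇒rows q b b w x leafRows)
      where
      w : Fin (suc k) → ℤ
      w (suc j) = _∣_.quotient (halves j)
      -- This value makes the row of π_p hold; the row of the first leaf then follows from M b =
      -- `total q x` by `balance`.
      w zero    = N x b + sumℤ (λ j → P x b - w (suc j))
      leaf-row′ : ∀ j → + 2 * w (suc j) - P x b ≡ x (leaf q (suc j))
      leaf-row′ j = trans (cong (λ u → + 2 * w (suc j) - u) (P-eq x b))
        (linear-consequence (- + 1) (solved (w (suc j)) (x (leaf q (suc j))) (A * b) (drift q x)) (_∣_.equality (halves j)))
        where
        solved : ∀ w x c d → + 2 * w - (c + d) - x ≡ - + 1 * (x + c + d - w * + 2)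
        solved = solve-∀
      leafRows : LeafRows q (P x b) (N x b) w x
      leafRows = regroup (N x b) (sumℤ (λ j → P x b - w (suc j))) (P x b) , λ
        { zero → trans (expand (N x b) (sumℤ (λ j → P x b - w (suc j))) (P x b))
            (trans (cong (λ u → + 2 * N x b + u - P x b) (doubled-sum x b (w ∘ suc) (x ∘ leaf q ∘ suc) leaf-row′))
            (linear-consequence (+ 1) (solved (N x b) (+ k) (P x b) (x (leaf q zero)) (sumℤ (x ∘ leaf q ∘ suc)))
              (trans (sym (balance x b)) (i≡j⇒i-j≡0 Mb≡total))))
        ; (suc j) → leaf-row′ j }
        where
        regroup : ∀ N S P → N + (P - (N + S) + S) ≡ P
        regroup = solve-∀
        expand : ∀ N S P → + 2 * (N + S) - P ≡ + 2 * N + + 2 * S - P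
        expand = solve-∀
        solved : ∀ N k P x s → + 2 * N + (k * P - s) - P - x ≡ + 1 * (+ 2 * N + k * P - P - (x + s) - + 0)
        solved = solve-∀

    firable⇔solvable : ∀ x → Firable (coneCT (suc q) (suc k)) x ⇔ Solvable x
    firable⇔solvable x = mk⇔ (firable⇒solvable x) (solvable⇒firable x)

  -- Source of the preimages for surjectivity: on vectors supported on the leaves both drifts vanish
  -- and `total` is the plain sum.
  onLeaves : ∀ q {s} → (Fin s → ℤ) → Fin (suc q ℕ.+ s) → ℤ
  onLeaves q       y zero    = + 0
  onLeaves zero    y (suc j) = y j
  onLeaves (suc q) y (suc i) = onLeaves q y i

  onLeaves-leaf : ∀ q {s} (y : Fin s → ℤ) j → onLeaves q y (leaf q j) ≡ y j
  onLeaves-leaf zero    y j = refl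
  onLeaves-leaf (suc q) y j = onLeaves-leaf q y j

  onLeaves-drift : ∀ q {s} (y : Fin s → ℤ) → drift q (onLeaves q y) ≡ + 0
  onLeaves-drift zero    y = refl
  onLeaves-drift (suc q) y = cong₂ _-_ (onLeaves-drift q y) (*-zeroʳ (F (suc (suc (q ℕ.* 2)))))

  onLeaves-drift′ : ∀ q {s} (y : Fin s → ℤ) → drift′ q (onLeaves q y) ≡ + 0
  onLeaves-drift′ zero    y = refl
  onLeaves-drift′ (suc q) y = cong₂ _-_ (onLeaves-drift′ q y) (*-zeroʳ (F (suc (suc (suc (suc (q ℕ.* 2)))))))

  onLeaves-total : ∀ q {k} (y : Fin (suc k) → ℤ) → total q (onLeaves q y) ≡ sumℤ y
  onLeaves-total q {k} y = trans
    (cong₂ (λ u v → u - + 2 * v)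
      (cong₂ (λ u v → u + (+ 1 - + k) * v) (sum-cong (onLeaves-leaf q y)) (onLeaves-drift q y))
      (onLeaves-drift′ q y))
    (solved (sumℤ y) (+ 1 - + k))
    where
    solved : ∀ s c → s + c * + 0 - + 2 * + 0 ≡ s
    solved = solve-∀

  -- The two isomorphisms.

  +m≡M : ∀ q k → + m (suc q) (suc k) ≡ Criterion.M q k
  +m≡M q k = trans (cong +_ (m-fib q (suc k)))
    (cong₂ _+_ (pos-* (suc k) (fib (suc (q ℕ.* 2)))) (pos-* 2 (fib (suc (suc (q ℕ.* 2))))))

  -- For even F_{2p-1} the term F_{2p-1} b drops out of the parities, which become independent of b.
  -- Evenness is asked for only given some `Fin k`, so the case s = 1 is included for every p.
  evenIso : ∀ q k → (Fin k → + 2 ∣ F (suc (q ℕ.* 2))) → SandpileIso (coneCT (suc q) (suc k)) (twosAnd k (m (suc q) (suc k)))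
  evenIso q k even = sandpileIso (coneCT (suc q) (suc k)) k (m (suc q) (suc k)) t (total q) lin-t (linear-total q) kernel onto
    where
    open Criterion q k
    t : (Fin (suc q ℕ.+ suc k) → ℤ) → Fin k → ℤ
    t x j = x (leaf q (suc j)) + drift q x
    lin-t : ∀ j → Linear (λ x → t x j)
    lin-t j c d {w} {x} {y} eq = trans (cong₂ _+_ (eq (leaf q (suc j))) (linear-drift q c d eq))
      (regroup c d (x (leaf q (suc j))) (y (leaf q (suc j))) (drift q x) (drift q y))
      where
      regroup : ∀ c d x y u v → c * x + d * y + (c * u + d * v) ≡ c * (x + u) + d * (y + v)
      regroup = solve-∀
    shift-by : ∀ {b} j x → x (leaf q (suc j)) + F (suc (q ℕ.* 2)) * b + drift q x ≡ F (suc (q ℕ.* 2)) * b + t x j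
    shift-by {b} j x = solved (x (leaf q (suc j))) (F (suc (q ℕ.* 2)) * b) (drift q x)
      where
      solved : ∀ x c d → x + c + d ≡ c + (x + d)
      solved = solve-∀
    kernel : ∀ x → Firable (coneCT (suc q) (suc k)) x ⇔ ((∀ j → + 2 ∣ t x j) × + m (suc q) (suc k) ∣ total q x)
    kernel x = mk⇔
      (λ fire → let (b , Mb , halves) = to (firable⇔solvable x) fire in
        (λ j → ∣m+n∣m⇒∣n (subst (+ 2 ∣_) (shift-by j x) (halves j)) (∣m⇒∣m*n b (even j))) ,
        divides b (trans (sym Mb) (trans (cong (_* b) (sym (+m≡M q k))) (comm (+ m (suc q) (suc k)) b))))
      (λ { (twos , divides b total≡) → from (firable⇔solvable x)
        (b , sym (trans total≡ (trans (comm b (+ m (suc q) (suc k))) (cong (_* b) (+m≡M q k)))) ,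
         λ j → subst (+ 2 ∣_) (sym (shift-by j x)) (∣m∣n⇒∣m+n (∣m⇒∣m*n b (even j)) (twos j))) })
      where
      comm : ∀ a b → a * b ≡ b * a
      comm = solve-∀
    onto : ∀ t′ r′ → ∃ λ x → (∀ j → t x j ≡ t′ j) × total q x ≡ r′
    onto t′ r′ = onLeaves q y ,
      (λ j → trans (cong₂ _+_ (onLeaves-leaf q y (suc j)) (onLeaves-drift q y)) (+-identityʳ (t′ j))) ,
      trans (onLeaves-total q y) (solved r′ (sumℤ t′))
      where
      y : Fin (suc k) → ℤ
      -- The first leaf, on which no `t` depends, adjusts the sum to `r′`.
      y zero    = r′ - sumℤ t′
      y (suc j) = t′ j
      solved : ∀ r s → r - s + s ≡ r
      solved = solve-∀

  -- For odd F_{2p-1} the parity condition at the leaf `ref` says b ≡ drift + ref (mod 2). Given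
  -- this one, those at the later leaves say that they agree with `ref` mod 2.
  oddIso : ∀ q k h → F (suc (q ℕ.* 2)) ≡ + 1 + + 2 * h →
    SandpileIso (coneCT (suc q) (suc (suc k))) (twosAnd k (2 ℕ.* m (suc q) (suc (suc k))))
  oddIso q k h odd = sandpileIso (coneCT (suc q) (suc (suc k))) k (2 ℕ.* m (suc q) (suc (suc k))) t r lin-t lin-r kernel onto
    where
    open Criterion q (suc k)
    A = F (suc (q ℕ.* 2))
    V = Fin (suc q ℕ.+ suc (suc k)) → ℤ
    ref : V → ℤ
    ref x = x (leaf q (suc zero))
    t : V → Fin k → ℤ
    t x j = x (leaf q (suc (suc j))) - ref x
    -- Substituting b = 2c - drift - ref into M b = total gives r x = 2 M c.
    r : V → ℤ
    r x = total q x + M * (drift q x + ref x)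
    lin-t : ∀ j → Linear (λ x → t x j)
    lin-t j c d {w} {x} {y} eq = trans (cong₂ _-_ (eq (leaf q (suc (suc j)))) (eq (leaf q (suc zero))))
      (regroup c d (x (leaf q (suc (suc j)))) (y (leaf q (suc (suc j)))) (ref x) (ref y))
      where
      regroup : ∀ c d x y u v → c * x + d * y - (c * u + d * v) ≡ c * (x - u) + d * (y - v)
      regroup = solve-∀
    lin-r : Linear r
    lin-r c d {w} {x} {y} eq = trans
      (cong₂ (λ u v → u + M * v) (linear-total q c d eq) (cong₂ _+_ (linear-drift q c d eq) (eq (leaf q (suc zero)))))
      (regroup c d M (total q x) (total q y) (drift q x) (drift q y) (ref x) (ref y))
      where
      regroup : ∀ c d M g g′ u u′ v v′ → c * g + d * g′ + M * (c * u + d * u′ + (c * v + d * v′)) ≡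
        c * (g + M * (u + v)) + d * (g′ + M * (u′ + v′))
      regroup = solve-∀
    +2m≡2M : + (2 ℕ.* m (suc q) (suc (suc k))) ≡ + 2 * M
    +2m≡2M = trans (pos-* 2 (m (suc q) (suc (suc k)))) (cong (+ 2 *_) (+m≡M q (suc k)))
    kernel : ∀ x → Firable (coneCT (suc q) (suc (suc k))) x ⇔ ((∀ j → + 2 ∣ t x j) × + (2 ℕ.* m (suc q) (suc (suc k))) ∣ r x)
    kernel x = mk⇔
      (λ fire → fwd (to (firable⇔solvable x) fire))
      (λ { (twos , divides c r≡) → from (firable⇔solvable x) (bwd twos c (trans r≡ (cong (c *_) +2m≡2M))) })
      where
      fwd : Solvable x → (∀ j → + 2 ∣ t x j) × + (2 ℕ.* m (suc q) (suc (suc k))) ∣ r x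
      fwd (b , Mb , halves) with halves zero
      ... | divides y₀ y₀≡ =
        (λ j → twos j (halves (suc j))) ,
        -- From ref + (1 + 2h) b + drift = 2 y₀ follows b + drift + ref = 2 (y₀ - h b).
        divides (y₀ - h * b) (trans
          (trans (cong (_+ M * (drift q x + ref x)) (sym Mb))
            (linear-consequence M (solved M b (ref x) (drift q x) y₀ h) (trans (cong (λ u → ref x + u * b + drift q x) (sym odd)) y₀≡)))
          (cong ((y₀ - h * b) *_) (sym +2m≡2M)))
        where
        solved : ∀ M b u d y h → M * b + M * (d + u) - (y - h * b) * (+ 2 * M) ≡ M * (u + (+ 1 + + 2 * h) * b + d - y * + 2)
        solved = solve-∀
        twos : ∀ j → + 2 ∣ x (leaf q (suc (suc j))) + A * b + drift q x → + 2 ∣ t x j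
        twos j (divides y y≡) = divides (y - y₀) (trans
          (cancel (x (leaf q (suc (suc j)))) (ref x) (A * b) (drift q x))
          (trans (cong₂ _-_ y≡ y₀≡) (factor y y₀)))
          where
          cancel : ∀ u v c d → u - v ≡ (u + c + d) - (v + c + d)
          cancel = solve-∀
          factor : ∀ y z → y * + 2 - z * + 2 ≡ (y - z) * + 2
          factor = solve-∀
      bwd : (∀ j → + 2 ∣ t x j) → ∀ c → r x ≡ c * (+ 2 * M) → Solvable x
      bwd twos c r≡ = b , linear-consequence (- + 1) (solved M c (drift q x) (ref x) (total q x)) r≡ , halves
        where
        b = + 2 * c - drift q x - ref x
        solved : ∀ M c d u g → M * (+ 2 * c - d - u) - g ≡ - + 1 * (g + M * (d + u) - c * (+ 2 * M))
        solved = solve-∀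
        at-ref : ref x + A * b + drift q x ≡ (c + h * b) * + 2
        at-ref = trans (cong (λ u → ref x + u * b + drift q x) odd) (even (ref x) (drift q x) c h)
          where
          even : ∀ u d c h → u + (+ 1 + + 2 * h) * (+ 2 * c - d - u) + d ≡ (c + h * (+ 2 * c - d - u)) * + 2
          even = solve-∀
        halves : ∀ j → + 2 ∣ x (leaf q (suc j)) + A * b + drift q x
        halves zero    = divides (c + h * b) at-ref
        halves (suc j) = subst (+ 2 ∣_) (shift-ref (x (leaf q (suc (suc j)))) (ref x) (A * b) (drift q x))
          (∣m∣n⇒∣m+n (twos j) (divides (c + h * b) at-ref))
          where
          shift-ref : ∀ u v c d → u - v + (v + c + d) ≡ u + c + d
          shift-ref = solve-∀
    onto : ∀ t′ r′ → ∃ λ x → (∀ j → t x j ≡ t′ j) × r x ≡ r′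
    onto t′ r′ = onLeaves q y ,
      (λ j → trans (cong₂ _-_ (onLeaves-leaf q y (suc (suc j))) (onLeaves-leaf q y (suc zero))) (+-identityʳ (t′ j))) ,
      trans (cong₂ (λ u v → u + M * v) (onLeaves-total q y) (cong₂ _+_ (onLeaves-drift q y) (onLeaves-leaf q y (suc zero))))
        (solved r′ (sumℤ t′) M)
      where
      y : Fin (suc (suc k)) → ℤ
      -- The value 0 at `ref` turns the differences into `t′` and removes the multiple of `M` from
      -- `r`; the first leaf corrects the sum.
      y zero          = r′ - sumℤ t′
      y (suc zero)    = + 0
      y (suc (suc j)) = t′ j
      solved : ∀ r s M → r - s + (+ 0 + s) + M * (+ 0 + + 0) ≡ r
      solved = solve-∀

  -- Parity of Fibonacci numbers.

  fib-mod-2 : ∀ r n → ∃ λ h → F (n ℕ.* 3 ℕ.+ r) ≡ F r + + 2 * h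
  fib-mod-2 r zero    = + 0 , sym (+-identityʳ (F r))
  fib-mod-2 r (suc n) with fib-mod-2 r n
  -- F_{i+3} = F_i + 2 F_{i+1}, so parities repeat with period 3.
  ... | h , eq = h + F (suc (n ℕ.* 3 ℕ.+ r)) , trans
    (cong (λ u → F (suc (n ℕ.* 3 ℕ.+ r)) + u + F (suc (n ℕ.* 3 ℕ.+ r))) eq)
    (solved (F (suc (n ℕ.* 3 ℕ.+ r))) (F r) h)
    where
    solved : ∀ g f h → g + (f + + 2 * h) + g ≡ f + + 2 * (h + g)
    solved = solve-∀

  fib-mod-2-at : ∀ {i} r n → i ≡ n ℕ.* 3 ℕ.+ r → ∃ λ h → F i ≡ F r + + 2 * h
  fib-mod-2-at r n refl = fib-mod-2 r n

  -- For p = 3t + 2 the index 2p - 1 is 6t + 3, and F_3 = 2.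
  fib-even : ∀ q → suc q % 3 ≡ 2 → + 2 ∣ F (suc (q ℕ.* 2))
  fib-even q q%3≡2 with suc q ℕ./ 3 | trans (m≡m%n+[m/n]*n (suc q) 3) (cong (ℕ._+ suc q ℕ./ 3 ℕ.* 3) q%3≡2)
  ... | t | refl with fib-mod-2-at 3 (t ℕ.* 2) (eq t)
    where
    eq : ∀ t → suc (suc (t ℕ.* 3) ℕ.* 2) ≡ t ℕ.* 2 ℕ.* 3 ℕ.+ 3
    eq = ℕ-solver.solve-∀
  ... | h , F≡ = divides (+ 1 + h) (trans F≡ (factor h))
    where
    factor : ∀ h → + 2 + + 2 * h ≡ (+ 1 + h) * + 2
    factor = solve-∀

  -- For p = 3 (t + 1) the index 2p - 1 is 6t + 5, and F_5 = 5; for p = 3t + 1 it is 6t + 1, and F_1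
  -- = 1.
  fib-odd : ∀ q → suc q % 3 ≡ 0 ⊎ suc q % 3 ≡ 1 → ∃ λ h → F (suc (q ℕ.* 2)) ≡ + 1 + + 2 * h
  fib-odd q (inj₁ q%3≡0) with suc q ℕ./ 3 | trans (m≡m%n+[m/n]*n (suc q) 3) (cong (ℕ._+ suc q ℕ./ 3 ℕ.* 3) q%3≡0)
  ... | suc t | refl with fib-mod-2-at 5 (t ℕ.* 2) (eq t)
    where
    eq : ∀ t → suc (suc (suc (t ℕ.* 3)) ℕ.* 2) ≡ t ℕ.* 2 ℕ.* 3 ℕ.+ 5
    eq = ℕ-solver.solve-∀
  ... | h , F≡ = + 2 + h , trans F≡ (factor h)
    where
    factor : ∀ h → + 5 + + 2 * h ≡ + 1 + + 2 * (+ 2 + h)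
    factor = solve-∀
  fib-odd q (inj₂ q%3≡1) with suc q ℕ./ 3 | trans (m≡m%n+[m/n]*n (suc q) 3) (cong (ℕ._+ suc q ℕ./ 3 ℕ.* 3) q%3≡1)
  ... | t | refl = fib-mod-2-at 1 (t ℕ.* 2) (eq t)
    where
    eq : ∀ t → suc (t ℕ.* 3 ℕ.* 2) ≡ t ℕ.* 2 ℕ.* 3 ℕ.+ 1
    eq = ℕ-solver.solve-∀

-- The tree count and both group structures together.

open import Data.Nat using (_*_)
open SpanningTrees using (numSpanningTrees)
open Sandpile using (evenIso; oddIso; fib-even; fib-odd)

theorem1p3 : (p s : ℕ) → 1 ≤ p → 1 ≤ s →
    NumSpanningTrees (coneCT p s) (2 ^ (s ∸ 1) * m p s)
    × ((s ≡ 1 ⊎ p % 3 ≡ 2) →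
    SandpileIso (coneCT p s) (replicate (s ∸ 1) 2 ++ (m p s ∷ [])))
    × ((2 ≤ s × (p % 3 ≡ 0 ⊎ p % 3 ≡ 1)) →
    SandpileIso (coneCT p s) (replicate (s ∸ 2) 2 ++ ((2 * m p s) ∷ [])))
theorem1p3 (suc q) (suc k) _ _ = numSpanningTrees q k , even-case , odd-case
  where
  even-case : suc k ≡ 1 ⊎ suc q % 3 ≡ 2 → SandpileIso (coneCT (suc q) (suc k)) (replicate k 2 ++ (m (suc q) (suc k) ∷ []))
  even-case (inj₁ refl)  = evenIso q 0 (λ ())
  even-case (inj₂ q%3≡2) = evenIso q k (λ _ → fib-even q q%3≡2)
  odd-case : 2 ≤ suc k × (suc q % 3 ≡ 0 ⊎ suc q % 3 ≡ 1) →
    SandpileIso (coneCT (suc q) (suc k)) (replicate (suc k ∸ 2) 2 ++ ((2 * m (suc q) (suc k)) ∷ []))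
  odd-case (s≤s (s≤s {n = j} _) , residue) = let (h , odd) = fib-odd q residue in oddIso q j h odd
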